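{- Let $M,N\ge3$ be integers. (1) For all $x\in\{ -1,1\}^N$, $y\in\{ -1,1\}^M$, every trivial toroidal Hitomezashi loop in $\mathrm{Cloth}_{M,N}(x,y)$ has length congruent to $4$ modulo $8$. (2) For all $x\in\{ -1,1\}^N$, every nontrivial toroidal Hitomezashi loop in the symmetric pattern $\mathrm{Cloth}_{N,N}(x,x)$ has length congruent to $2|k(x)|$ modulo $8$. (3) For all $x\in\{ -1,1\}^N$, $y\in\{ -1,1\}^M$, if a nontrivial toroidal Hitomezashi loop in $\mathrm{Cloth}_{M,N}(x,y)$ has homology class $(\lambda,\mu)$, then its length is congruent to $2(\mu N+\lambda M-\mu k(x))$ modulo $8$.
   Context: Let $M,N\ge3$. $\mathrm{Cloth}_{M,N}$ is the graph with vertex set $\mathbb Z/M\mathbb Z\times\mathbb Z/N\mathbb Z$, with $(i,j)$ adjacent to $(i\pm1,j)$ and $(i,j\pm1)$. For $x\in\{ -1,1\}^N$ (indexed by $\mathbb Z/N\mathbb Z$) and $y\in\{ -1,1\}^M$ (indexed by $\mathbb Z/M\mathbb Z$), the toroidal Hitomezashi pattern $\mathrm{Cloth}_{M,N}(x,y)$ is the following orientation of $\mathrm{Cloth}_{M,N}$: the horizontal edge $\{(i,j),(i+1,j)\}$ is oriented $(i,j)\to(i+1,j)$ if $x_j=1$ and $(i+1,j)\to(i,j)$ if $x_j=-1$; the vertical edge $\{(i,j),(i,j+1)\}$ is oriented $(i,j)\to(i,j+1)$ if $y_i=1$ and $(i,j+1)\to(i,j)$ if $y_i=-1$. The pattern is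 symmetric if $M=N$ and $x=y$. A toroidal Hitomezashi loop is a directed circuit (closed directed trail, no repeated edges, considered up to cyclic shift) in $\mathrm{Cloth}_{M,N}(x,y)$ whose edges alternate (cyclically) between vertical and horizontal edges; a loop may pass through a vertex twice. Its length is its number of edges. For a loop, $\Delta x$ is the number of its edges of the form $(i,j)\to(i+1,j)$ minus the number of its edges of the form $(i+1,j)\to(i,j)$, and $\Delta y$ is the number of its edges of the form $(i,j)\to(i,j+1)$ minus the number of the form $(i,j+1)\to(i,j)$. The homology class of the loop is $(\Delta x/M,\Delta y/N)$. A loop is trivial if its homology class is $(0,0)$ and nontrivial otherwise. For a string $x$ of $\pm1$'s, $k(x)$ is the number of $1$'s minus the number of $(-1)$'s in $x$. -}

module Defs where

open import Data.Nat as ℕ using (ℕ; zero; suc; NonZero)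
import Data.Nat.Properties as ℕ
import Data.Nat.DivMod as ℕ
open import Data.Integer using (ℤ; +_; -[1+_]; 0ℤ; 1ℤ; -1ℤ; _+_; _-_; _*_; -_)
import Data.Integer.Properties as ℤ
open import Data.Integer.Divisibility.Signed
  using (_∣_; divides; quotient; ∣m∣n⇒∣m+n; ∣m⇒∣-m)
open import Data.Integer.Tactic.RingSolver using (solve-∀)
open import Data.Fin as Fin using (Fin; zero; suc; toℕ; fromℕ; inject₁)
import Data.Fin.Properties as Fin
open import Data.Product using (_×_; _,_; proj₁; proj₂)
import Data.Product.Properties as Product
open import Data.Sign using (Sign)
import Data.Sign.Properties as Sign
open import Data.Vec using (Vec; []; _∷_; lookup; count)
open import Function using (_∘_)
open import Function.Definitions using (Injective)
open import Relation.Binary.Definitions using (DecidableEquality)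
open import Relation.Binary.PropositionalEquality
  using (_≡_; _≢_; refl; sym; trans; cong; cong₂; subst)
open import Relation.Nullary using (yes; no)
open import Algebra.Properties.CommutativeMonoid.Sum ℤ.+-0-commutativeMonoid
  using (sum; sum-cong-≗; sum-init-last; ∑-distrib-+)

infix 4 _≡_[mod_]

_≡_[mod_] : ℤ → ℤ → ℤ → Set
i ≡ j [mod m ] = m ∣ i - j

-- Fin n represents ℤ/nℤ, and next is addition of 1 modulo n.
next : ∀ {n} → Fin n → Fin n
next {suc n} i = suc (toℕ i) ℕ.mod suc n

data Axis : Set where
  horizontal vertical : Axis

_≟ᴬ_ : DecidableEquality Axis
horizontal ≟ᴬ horizontal = yes refl
horizontal ≟ᴬ vertical   = no λ ()
vertical   ≟ᴬ horizontal = no λ ()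
vertical   ≟ᴬ vertical   = yes refl

_≟ᴴ_ : DecidableEquality (Axis × Sign)
_≟ᴴ_ = Product.≡-dec _≟ᴬ_ Sign._≟_

Vertex : ℕ → ℕ → Set
Vertex M N = Fin M × Fin N

-- (horizontal , (i , j)) is the undirected edge {(i,j), (i+1,j)} and
-- (vertical , (i , j)) is the undirected edge {(i,j), (i,j+1)}.  For M, N ≥ 3
-- these 2MN edges have pairwise distinct endpoint sets, so they are exactly
-- the edges of the simple graph Cloth(M,N).
Edge : ℕ → ℕ → Set
Edge M N = Axis × Vertex M N

axis : ∀ {M N} → Edge M N → Axis
axis = proj₁

-- The pattern Cloth(M,N)(x,y): the orientation of each edge.  Note that x has
-- one entry for each row j ∈ ℤ/Nℤ and y one for each column i ∈ ℤ/Mℤ.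
module _ {M N : ℕ} (x : Vec Sign N) (y : Vec Sign M) where

  sign : Edge M N → Sign
  sign (horizontal , (i , j)) = lookup x j
  sign (vertical   , (i , j)) = lookup y i

  base far : Edge M N → Vertex M N
  base (_ , v) = v
  far (horizontal , (i , j)) = next i , j
  far (vertical   , (i , j)) = i , next j

  source target : Edge M N → Vertex M N
  source e with sign e
  ... | Sign.+ = base e
  ... | Sign.- = far e
  target e with sign e
  ... | Sign.+ = far e
  ... | Sign.- = base e

  -- E.g. (horizontal , +) for an edge oriented (i,j) → (i+1,j), and
  -- (horizontal , -) for an edge oriented (i+1,j) → (i,j).
  heading : Edge M N → Axis × Sign
  heading e = axis e , sign e

  #heading : Axis × Sign → ∀ {n} → Vec (Edge M N) n → ℕ
  #heading h = count (λ e → heading e ≟ᴴ h)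

  -- A loop with a chosen first edge.  The edges are indexed cyclically, by
  -- ℤ/(length)ℤ, so a cyclic shift of a loop is a loop with the same length
  -- and homology class.
  record Loop : Set where
    field
      length      : ℕ
      nonempty    : NonZero length
      edges       : Vec (Edge M N) length
      connected   : ∀ k → target (lookup edges k) ≡ source (lookup edges (next k))
      trail       : Injective _≡_ _≡_ (lookup edges)
      alternating : ∀ k → axis (lookup edges k) ≢ axis (lookup edges (next k))

open Loop public using (length)

module _ {M N : ℕ} {x : Vec Sign N} {y : Vec Sign M} (L : Loop x y) where

  Δ : Axis → ℤ
  Δ a = + #heading x y (a , Sign.+) (Loop.edges L)
        - + #heading x y (a , Sign.-) (Loop.edges L)

  Δx Δy : ℤ
  Δx = Δ horizontal
  Δy = Δ vertical

-- M divides Δx and N divides Δy, which makes the homology class integral.  The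
-- proof compares Δ with the telescoping sum of the changes of a coordinate.

mod-step : ∀ {n} (i : Fin n) → + n ∣ (1ℤ - (+ toℕ (next i) - + toℕ i))
mod-step {suc n} i = divides (+ q) (begin
  1ℤ - (+ toℕ (next i) - + toℕ i)  ≡⟨ cong (λ t → 1ℤ - (+ t - + toℕ i)) toℕ-next ⟩
  1ℤ - (+ r - + toℕ i)             ≡⟨ rearrange (+ r) (+ toℕ i) ⟩
  (1ℤ + + toℕ i) - + r             ≡⟨ cong (_- + r) split ⟩
  (+ r + + q * + suc n) - + r      ≡⟨ cancel (+ r) (+ q * + suc n) ⟩
  + q * + suc n                    ∎)
  where
  open Relation.Binary.PropositionalEquality.≡-Reasoning
  r q : ℕ
  r = suc (toℕ i) ℕ.% suc n
  q = suc (toℕ i) ℕ./ suc n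
  toℕ-next : toℕ (next i) ≡ r
  toℕ-next = Fin.toℕ-fromℕ< _
  rearrange : ∀ a b → 1ℤ - (a - b) ≡ (1ℤ + b) - a
  rearrange = solve-∀
  cancel : ∀ a b → (a + b) - a ≡ b
  cancel = solve-∀
  split : + suc (toℕ i) ≡ + r + + q * + suc n
  split = trans (cong (λ t → + t) (ℕ.m≡m%n+[m/n]*n (suc (toℕ i)) (suc n)))
                (cong (λ t → + r + t) (ℤ.pos-* q (suc n)))

next-inject₁ : ∀ {n} (i : Fin n) → next (inject₁ i) ≡ suc i
next-inject₁ {n} i = Fin.toℕ-injective (trans (Fin.toℕ-fromℕ< _)
  (trans (cong (λ t → suc t ℕ.% suc n) (Fin.toℕ-inject₁ i))
         (ℕ.m<n⇒m%n≡m (ℕ.s≤s (Fin.toℕ<n i)))))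

next-fromℕ : ∀ n → next (fromℕ n) ≡ zero
next-fromℕ n = Fin.toℕ-injective (trans (Fin.toℕ-fromℕ< _)
  (trans (cong (λ t → suc t ℕ.% suc n) (Fin.toℕ-fromℕ n)) (ℕ.n%n≡0 (suc n))))

sum-next : ∀ {n} (g : Fin n → ℤ) → sum (g ∘ next) ≡ sum g
sum-next {zero}  g = refl
sum-next {suc n} g = trans (sum-init-last (g ∘ next))
  (trans (cong₂ _+_ (sum-cong-≗ (cong g ∘ next-inject₁)) (cong g (next-fromℕ n)))
         (ℤ.+-comm (sum (g ∘ suc)) (g zero)))

∣-sum : ∀ {m n} (g : Fin n → ℤ) → (∀ k → m ∣ g k) → m ∣ sum g
∣-sum {n = zero}  g m∣g = divides 0ℤ refl
∣-sum {n = suc n} g m∣g = ∣m∣n⇒∣m+n (m∣g zero) (∣-sum (g ∘ suc) (m∣g ∘ suc))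

displacement : Axis → Axis × Sign → ℤ
displacement horizontal (horizontal , Sign.+) = 1ℤ
displacement horizontal (horizontal , Sign.-) = -1ℤ
displacement horizontal (vertical   , s)      = 0ℤ
displacement vertical   (vertical   , Sign.+) = 1ℤ
displacement vertical   (vertical   , Sign.-) = -1ℤ
displacement vertical   (horizontal , s)      = 0ℤ

circumference : ℕ → ℕ → Axis → ℕ
circumference M N horizontal = M
circumference M N vertical   = N

coordinate : ∀ {M N} → Axis → Vertex M N → ℤ
coordinate horizontal (i , j) = + toℕ i
coordinate vertical   (i , j) = + toℕ j

flip : ∀ a b → - (1ℤ - (a - b)) ≡ -1ℤ - (b - a)
flip = solve-∀

vanish : ∀ a → 0ℤ - (a - a) ≡ 0ℤ
vanish = solve-∀

shift : ∀ a b → -1ℤ + (a - b) ≡ a - (1ℤ + b)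
shift = solve-∀

module _ {M N : ℕ} (x : Vec Sign N) (y : Vec Sign M) where

  ∣-edge : ∀ a (e : Edge M N) → + circumference M N a ∣
    (displacement a (heading x y e)
      - (coordinate a (target x y e) - coordinate a (source x y e)))
  ∣-edge a e with sign x y e
  ∣-edge horizontal (horizontal , (i , j)) | Sign.+ = mod-step i
  ∣-edge horizontal (horizontal , (i , j)) | Sign.- =
    subst (_ ∣_) (flip (+ toℕ (next i)) (+ toℕ i)) (∣m⇒∣-m (mod-step i))
  ∣-edge vertical (vertical , (i , j)) | Sign.+ = mod-step j
  ∣-edge vertical (vertical , (i , j)) | Sign.- =
    subst (_ ∣_) (flip (+ toℕ (next j)) (+ toℕ j)) (∣m⇒∣-m (mod-step j))
  ∣-edge horizontal (vertical , (i , j)) | Sign.+ = divides 0ℤ (vanish (+ toℕ i))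
  ∣-edge horizontal (vertical , (i , j)) | Sign.- = divides 0ℤ (vanish (+ toℕ i))
  ∣-edge vertical (horizontal , (i , j)) | Sign.+ = divides 0ℤ (vanish (+ toℕ j))
  ∣-edge vertical (horizontal , (i , j)) | Sign.- = divides 0ℤ (vanish (+ toℕ j))

  sum-displacement : ∀ a {n} (es : Vec (Edge M N) n) →
    sum (displacement a ∘ heading x y ∘ lookup es) ≡
    + #heading x y (a , Sign.+) es - + #heading x y (a , Sign.-) es
  sum-displacement a []       = refl
  sum-displacement a (e ∷ es) with sign x y e | sum-displacement a es
  sum-displacement horizontal ((horizontal , v) ∷ es) | Sign.+ | ih =
    trans (cong (λ t → 1ℤ + t) ih)
      (sym (ℤ.+-assoc 1ℤ (+ #heading x y (horizontal , Sign.+) es) (- + #heading x y (horizontal , Sign.-) es)))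
  sum-displacement horizontal ((horizontal , v) ∷ es) | Sign.- | ih =
    trans (cong (λ t → -1ℤ + t) ih)
      (shift (+ #heading x y (horizontal , Sign.+) es) (+ #heading x y (horizontal , Sign.-) es))
  sum-displacement horizontal ((vertical , v) ∷ es) | s | ih = trans (ℤ.+-identityˡ _) ih
  sum-displacement vertical ((vertical , v) ∷ es) | Sign.+ | ih =
    trans (cong (λ t → 1ℤ + t) ih)
      (sym (ℤ.+-assoc 1ℤ (+ #heading x y (vertical , Sign.+) es) (- + #heading x y (vertical , Sign.-) es)))
  sum-displacement vertical ((vertical , v) ∷ es) | Sign.- | ih =
    trans (cong (λ t → -1ℤ + t) ih)
      (shift (+ #heading x y (vertical , Sign.+) es) (+ #heading x y (vertical , Sign.-) es))
  sum-displacement vertical ((horizontal , v) ∷ es) | s | ih = trans (ℤ.+-identityˡ _) ih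

  ∣Δ : (L : Loop x y) (a : Axis) → + circumference M N a ∣ Δ L a
  ∣Δ L a = subst (_ ∣_) total (∣-sum _ (λ k → ∣-edge a (e k)))
    where
    open Relation.Binary.PropositionalEquality.≡-Reasoning
    e : Fin (length L) → Edge M N
    e = lookup (Loop.edges L)
    d s t : Fin (length L) → ℤ
    d = displacement a ∘ heading x y ∘ e
    s = coordinate a ∘ source x y ∘ e
    t = coordinate a ∘ target x y ∘ e
    regroup : ∀ p q r → (p - (q - r)) + q ≡ p + r
    regroup = solve-∀
    cancel : ∀ p q → (p + q) - q ≡ p
    cancel = solve-∀
    sum-t : sum t ≡ sum s
    sum-t = trans (sum-cong-≗ (cong (coordinate a) ∘ Loop.connected L)) (sum-next s)
    c : Fin (length L) → ℤ
    c k = d k - (t k - s k)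
    total : sum c ≡ Δ L a
    total = begin
      sum c                        ≡⟨ cancel (sum c) (sum t) ⟨
      (sum c + sum t) - sum t      ≡⟨ cong (_- sum t) (∑-distrib-+ c t) ⟨
      sum (λ k → c k + t k) - sum t
        ≡⟨ cong (_- sum t) (sum-cong-≗ (λ k → regroup (d k) (t k) (s k))) ⟩
      sum (λ k → d k + s k) - sum t  ≡⟨ cong₂ _-_ (∑-distrib-+ d s) sum-t ⟩
      (sum d + sum s) - sum s      ≡⟨ cancel (sum d) (sum s) ⟩
      sum d                        ≡⟨ sum-displacement a (Loop.edges L) ⟩
      Δ L a                        ∎

module _ {M N : ℕ} {x : Vec Sign N} {y : Vec Sign M} (L : Loop x y) where

  abstract
    M∣Δx : + M ∣ Δx L
    M∣Δx = ∣Δ x y L horizontal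

    N∣Δy : + N ∣ Δy L
    N∣Δy = ∣Δ x y L vertical

  -- (Δx/M , Δy/N), the divisions being exact.
  homologyClass : ℤ × ℤ
  homologyClass = quotient M∣Δx , quotient N∣Δy

  Trivial Nontrivial : Set
  Trivial    = homologyClass ≡ (0ℤ , 0ℤ)
  Nontrivial = homologyClass ≢ (0ℤ , 0ℤ)

k : ∀ {n} → Vec Sign n → ℤ
k x = + count (Sign._≟ Sign.+) x - + count (Sign._≟ Sign.-) x

{-# OPTIONS --safe #-}
-- Lift a loop to ℤ² and record the doubled midpoints (a, b) of its edges; they move by diagonal steps
-- (X, Y) ∈ {±1}².  Let h be the height function with increments x_j across row j (doubled, so that it
-- climbs by 2k(x) around the torus).  Each step changes h(b) by XY, so Σ XY = 2μk(x), Σ X = 2λM and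
-- Σ Y = 2μN.  Summing (1 - X)(1 - Y), which is 4 if X = Y = -1 and 0 otherwise, gives
--   length = 2λM + 2μN - 2μk(x) + 4 · #{steps with X = Y = -1}.
-- The number of such steps has the parity of the turning number of the midpoint curve, which is simple:
-- by Hopf's argument it is 0 for a nontrivial loop (compare tangents with chords spanning a whole period)
-- and ±1 for a trivial one (compare tangents with chords based at an extreme point).
--
-- In a symmetric pattern no loop crosses the diagonal, so λ = μ.  If k ≠ 0, the heights climb, and a
-- column and a row index at which the height first reaches suitable values bound a quadrant that the loop
-- can enter or leave only at its corner, in the direction given by the sign of k.  A trail passes that
-- corner at most once, hence λ is 0 or the sign of k, and λk = |k| for nontrivial loops.

module Submission where

open import Defs
open import Algebra.Properties.AbelianGroup using (∙-cancelˡ)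
open import Data.Empty using (⊥-elim)
open import Data.Fin as Fin using (Fin; zero; suc; toℕ)
import Data.Fin.Properties as Fin
open import Data.Integer as ℤ
  using (ℤ; +_; -[1+_]; 0ℤ; 1ℤ; -1ℤ; _+_; _-_; _*_; -_; ∣_∣; _⊔_; _/ℕ_; _%ℕ_; +≤+; -≤-; -≤+)
open import Data.Integer.DivMod using (a≡a%ℕn+[a/ℕn]*n; n%ℕd<d; n<s[n/ℕd]*d; [n/ℕd]*d≤n)
open import Data.Integer.Divisibility.Signed
  using (_∣_; divides; ∣⇒∣ᵤ; ∣m∣n⇒∣m+n; ∣m∣n⇒∣m-n)
import Data.Integer.Properties as ℤ
open import Data.Integer.Tactic.RingSolver using (solve-∀)
open import Data.Nat as ℕ using (ℕ; zero; suc; NonZero; _≤_)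
import Data.Nat.DivMod as ℕ
import Data.Nat.Divisibility as ℕ
import Data.Nat.Properties as ℕ
open import Data.Product using (_×_; _,_; proj₁; proj₂; ∃-syntax)
open import Data.Sign using (Sign)
import Data.Sign.Properties as Sign
open import Data.Sum as Sum using (_⊎_; inj₁; inj₂; [_,_]′)
open import Data.Vec using (Vec; []; _∷_; lookup; count)
open import Function using (_∘_)
open import Relation.Binary.Definitions using (Tri; tri<; tri≈; tri>)
open import Relation.Binary.PropositionalEquality
  using (_≡_; _≢_; refl; sym; trans; cong; cong₂; subst; subst₂; module ≡-Reasoning)
open import Relation.Nullary using (¬_; yes; no; contradiction)
open import Relation.Unary using (Decidable)
open import Algebra.Properties.CommutativeMonoid.Sum ℤ.+-0-commutativeMonoid using (sum)

-- A loop may pass a vertex twice but repeats no edge, so the curve through the edge midpoints is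
-- simple where the loop itself need not be. Angles are replaced by integers: the turning of a chord
-- vector is its signed number of crossings of one fixed ray. Around a unit square of index pairs
-- these crossings cancel unless a chord vanishes, so deforming a path of chords amounts to summing
-- over finitely many squares. Rotated by 45°, the midpoint steps become unit steps and X = Y = -1
-- points west; the ray is taken just north of west. Turns that keep X alternate with turns that
-- keep Y, and only the former can cross the ray, which is why the crossings agree with the number
-- of westward steps up to an even number.
--
-- For a trivial loop the displacement and the height gain vanish, and 4 times an odd number is 4
-- modulo 8. In a symmetric pattern λ = μ turns the general formula into 2(2λN - λk). Since N and k
-- have the same parity, this is 2λk modulo 8; for k = 0 it is 0 whatever λ is.

+-cancelˡ : ∀ i j l → i + j ≡ i + l → j ≡ l
+-cancelˡ = ∙-cancelˡ ℤ.+-0-abelianGroup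

-- Sums over initial segments and over periods

∑ : (ℕ → ℤ) → ℕ → ℤ
∑ f zero    = 0ℤ
∑ f (suc n) = ∑ f n + f n

∑-cong : ∀ {f g} → (∀ m → f m ≡ g m) → ∀ n → ∑ f n ≡ ∑ g n
∑-cong f≗g zero    = refl
∑-cong f≗g (suc n) = cong₂ _+_ (∑-cong f≗g n) (f≗g n)

∑-telescope : ∀ (P : ℕ → ℤ) f → (∀ m → P (suc m) ≡ P m + f m) → ∀ n → P n ≡ P 0 + ∑ f n
∑-telescope P f step zero    = sym (ℤ.+-identityʳ (P 0))
∑-telescope P f step (suc n) = trans (step n)
  (trans (cong (_+ f n) (∑-telescope P f step n)) (ℤ.+-assoc (P 0) (∑ f n) (f n)))

∑-head : ∀ f n → f 0 + ∑ (f ∘ suc) n ≡ ∑ f (suc n)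
∑-head f zero    = ℤ.+-comm (f 0) 0ℤ
∑-head f (suc n) = trans (sym (ℤ.+-assoc (f 0) _ _)) (cong (_+ f (suc n)) (∑-head f n))

∑-rotate : ∀ f n → f n ≡ f 0 → ∑ (f ∘ suc) n ≡ ∑ f n
∑-rotate f n fn≡f0 = +-cancelˡ (f 0) _ _ (trans (∑-head f n)
  (trans (cong (_+_ (∑ f n)) fn≡f0) (ℤ.+-comm (∑ f n) (f 0))))

∑-shift : ∀ f n → (∀ m → f (m ℕ.+ n) ≡ f m) → ∀ o → ∑ (λ m → f (m ℕ.+ o)) n ≡ ∑ f n
∑-shift f n per zero    = ∑-cong (λ m → cong f (ℕ.+-identityʳ m)) n
∑-shift f n per (suc o) = trans (∑-cong (λ m → cong f (ℕ.+-suc m o)) n)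
  (trans (∑-rotate (λ m → f (m ℕ.+ o)) n
           (trans (cong f (ℕ.+-comm n o)) (per o)))
         (∑-shift f n per o))

-- Winding numbers of lattice curves

data Adjacent (z z′ : ℤ) : Set where
  up   : z′ ≡ z + 1ℤ → Adjacent z z′
  down : z′ ≡ z - 1ℤ → Adjacent z z′

neg pos : ℤ → ℤ
neg (+ _)    = 0ℤ
neg -[1+ _ ] = 1ℤ
pos (+ zero)  = 0ℤ
pos (+ suc _) = 1ℤ
pos -[1+ _ ]  = 0ℤ

neg-adjacent : ∀ {z z′} → Adjacent z z′ → neg z ≡ neg z′ ⊎ z ≡ 0ℤ ⊎ z′ ≡ 0ℤ
neg-adjacent {+ n}            (up refl) = inj₁ refl
neg-adjacent { -[1+ zero ]}   (up refl) = inj₂ (inj₂ refl)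
neg-adjacent { -[1+ suc n ]}  (up refl) = inj₁ refl
neg-adjacent {+ zero}         (down refl) = inj₂ (inj₁ refl)
neg-adjacent {+ suc n}        (down refl) = inj₁ refl
neg-adjacent { -[1+ n ]}      (down refl) = inj₁ refl

pos-adjacent : ∀ {z z′} → Adjacent z z′ → pos z ≡ pos z′ ⊎ z ≡ 0ℤ ⊎ z′ ≡ 0ℤ
pos-adjacent {+ zero}         (up refl) = inj₂ (inj₁ refl)
pos-adjacent {+ suc n}        (up refl) = inj₁ refl
pos-adjacent { -[1+ zero ]}   (up refl) = inj₂ (inj₂ refl)
pos-adjacent { -[1+ suc n ]}  (up refl) = inj₁ refl
pos-adjacent {+ zero}         (down refl) = inj₂ (inj₁ refl)
pos-adjacent {+ suc zero}     (down refl) = inj₂ (inj₂ refl)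
pos-adjacent {+ suc (suc n)}  (down refl) = inj₁ refl
pos-adjacent { -[1+ n ]}      (down refl) = inj₁ refl

Origin : ℤ → ℤ → Set
Origin u t = u ≡ 0ℤ × t ≡ 0ℤ

-- The two sides of a unit square cross the ray differently only if `neg` changes between `u` and
-- `u′` and `pos` changes between `t` and `t′`. Each change needs a zero at one of its ends, and two
-- such zeros put a corner of the square at the origin.
corner : ∀ {u u′ t t′} → Adjacent u u′ → Adjacent t t′ →
  ¬ Origin u t → ¬ Origin u t′ → ¬ Origin u′ t → ¬ Origin u′ t′ →
  neg u * (pos t′ - pos t) ≡ neg u′ * (pos t′ - pos t)
corner {u} {u′} {t} {t′} u~u′ t~t′ ut ut′ u′t u′t′ with neg-adjacent u~u′ | pos-adjacent t~t′
... | inj₁ e        | _             = cong (_* _) e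
... | inj₂ _        | inj₁ e        = trans (cong (λ b → neg u * (pos t′ - b)) e)
  (trans (lemma (neg u) (neg u′) (pos t′)) (cong (λ b → neg u′ * (pos t′ - b)) (sym e)))
  where
  lemma : ∀ a b c → a * (c - c) ≡ b * (c - c)
  lemma = solve-∀
... | inj₂ (inj₁ p) | inj₂ (inj₁ q) = ⊥-elim (ut (p , q))
... | inj₂ (inj₁ p) | inj₂ (inj₂ q) = ⊥-elim (ut′ (p , q))
... | inj₂ (inj₂ p) | inj₂ (inj₁ q) = ⊥-elim (u′t (p , q))
... | inj₂ (inj₂ p) | inj₂ (inj₂ q) = ⊥-elim (u′t′ (p , q))

data Step (u t u′ t′ : ℤ) : Set where
  east-west   : Adjacent u u′ → t′ ≡ t → Step u t u′ t′
  north-south : u′ ≡ u → Adjacent t t′ → Step u t u′ t′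

adjacent-minus : ∀ {z z′} c → Adjacent z z′ → Adjacent (z - c) (z′ - c)
adjacent-minus {z} c (up refl) = up (lemma z c)
  where
  lemma : ∀ z c → z + 1ℤ - c ≡ z - c + 1ℤ
  lemma = solve-∀
adjacent-minus {z} c (down refl) = down (lemma z c)
  where
  lemma : ∀ z c → z - 1ℤ - c ≡ z - c - 1ℤ
  lemma = solve-∀

minus-adjacent : ∀ {z z′} c → Adjacent z z′ → Adjacent (c - z) (c - z′)
minus-adjacent {z} c (up refl) = down (lemma z c)
  where
  lemma : ∀ z c → c - (z + 1ℤ) ≡ c - z - 1ℤ
  lemma = solve-∀
minus-adjacent {z} c (down refl) = up (lemma z c)
  where
  lemma : ∀ z c → c - (z - 1ℤ) ≡ c - z + 1ℤ
  lemma = solve-∀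

module Winding (u t : ℕ → ℤ) (step : ∀ m → Step (u m) (t m) (u (suc m)) (t (suc m))) where

  Distinct : ℕ → ℕ → Set
  Distinct i j = ¬ Origin (u j - u i) (t j - t i)

  -- For a unit step (u, t) → (u′, t′), neg u * (pos t′ - pos t) counts with sign its crossing of the ray
  -- {u < 0, t = 1/2}.  Applied to the chord from i to j, α advances j and η advances i.
  α η : ℕ → ℕ → ℤ
  α i j = neg (u j - u i) * (pos (t (suc j) - t i) - pos (t j - t i))
  η i j = neg (u j - u i) * (pos (t j - t (suc i)) - pos (t j - t i))

  -- The crossings when the tangent at i turns into the tangent at i + 1 via the chord from i to i + 2.
  τ : ℕ → ℤ
  τ i = α i (suc i) + η i (suc (suc i))

  -- Crossings do not depend on the order in which the two ends of a chord advance. Parallel steps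
  -- sweep only a segment, where both orders telescope or vanish; perpendicular steps sweep a unit
  -- square, to which `corner` applies.
  flat : ∀ {i j} → Distinct i j → Distinct i (suc j) → Distinct (suc i) j → Distinct (suc i) (suc j) →
    α i j + η i (suc j) ≡ η i j + α (suc i) j
  flat {i} {j} d₁ d₂ d₃ d₄ with step i | step j
  ... | east-west _ p | east-west _ q rewrite p | q =
    lemma (neg (u j - u i)) (neg (u (suc j) - u i)) (neg (u j - u (suc i))) (pos (t j - t i))
    where
    lemma : ∀ a b c x → a * (x - x) + b * (x - x) ≡ a * (x - x) + c * (x - x)
    lemma = solve-∀
  ... | north-south p _ | north-south q _ rewrite p | q =
    lemma (neg (u j - u i)) (pos (t j - t i)) (pos (t (suc j) - t i)) (pos (t j - t (suc i)))
      (pos (t (suc j) - t (suc i)))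
    where
    lemma : ∀ a x₀ x₁ x₂ x₃ → a * (x₁ - x₀) + a * (x₃ - x₁) ≡ a * (x₂ - x₀) + a * (x₃ - x₂)
    lemma = solve-∀
  ... | north-south p tᵢ | east-west uⱼ q rewrite p | q =
    trans (lemma (neg (u j - u i)) (pos (t j - t i)) _)
      (trans (sym (corner (adjacent-minus (u i) uⱼ) (minus-adjacent (t j) tᵢ) d₁ d₃ d₂ d₄))
        (lemma′ _ (neg (u j - u i)) (pos (t j - t (suc i)))))
    where
    lemma : ∀ a x y → a * (x - x) + y ≡ y
    lemma = solve-∀
    lemma′ : ∀ y a x → y ≡ y + a * (x - x)
    lemma′ = solve-∀
  ... | east-west uᵢ p | north-south q tⱼ rewrite p | q =
    trans (lemma (neg (u j - u i)) (pos (t (suc j) - t i)) _)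
      (trans (corner (minus-adjacent (u j) uᵢ) (adjacent-minus (t i) tⱼ) d₁ d₂ d₃ d₄)
        (lemma′ _ (neg (u j - u i)) (pos (t j - t i))))
    where
    lemma : ∀ a x y → y + a * (x - x) ≡ y
    lemma = solve-∀
    lemma′ : ∀ y a x → y ≡ a * (x - x) + y
    lemma′ = solve-∀

  -- The crossings as the chord based at `i` swings from the tangent, ending at `i + 1`, to the
  -- chord ending at `i + d + 1`.
  C : ℕ → ℕ → ℤ
  C i zero    = 0ℤ
  C i (suc d) = C i d + α i (suc d ℕ.+ i)

  -- The squares of `flat` between the bases `i` and `suc i` are stacked on the triangle at the
  -- diagonal, whose two moves make up `τ i` by definition.
  strip : ∀ i d → (∀ d′ → d′ ℕ.≤ suc d → Distinct i (suc d′ ℕ.+ i)) →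
    (∀ d′ → d′ ℕ.≤ d → Distinct (suc i) (suc d′ ℕ.+ suc i)) →
    C i (suc d) + η i (suc (suc d) ℕ.+ i) ≡ τ i + C (suc i) d
  strip i zero    _  _  = trans (ℤ.+-assoc 0ℤ (α i (suc i)) _) (ℤ.+-comm 0ℤ (τ i))
  strip i (suc d) h₁ h₂ = begin
    C i (suc d) + α i j + η i (suc j)      ≡⟨ ℤ.+-assoc (C i (suc d)) _ _ ⟩
    C i (suc d) + (α i j + η i (suc j))    ≡⟨ cong (_+_ (C i (suc d))) square ⟩
    C i (suc d) + (η i j + α (suc i) j)    ≡⟨ ℤ.+-assoc (C i (suc d)) _ _ ⟨
    (C i (suc d) + η i j) + α (suc i) j
      ≡⟨ cong (_+ α (suc i) j) (strip i d (λ d′ → h₁ d′ ∘ ℕ.m≤n⇒m≤1+n) (λ d′ → h₂ d′ ∘ ℕ.m≤n⇒m≤1+n)) ⟩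
    (τ i + C (suc i) d) + α (suc i) j      ≡⟨ ℤ.+-assoc (τ i) _ _ ⟩
    τ i + (C (suc i) d + α (suc i) j)
      ≡⟨ cong (λ j′ → τ i + (C (suc i) d + α (suc i) j′)) (sym (ℕ.+-suc (suc d) i)) ⟩
    τ i + C (suc i) (suc d)                ∎
    where
    open ≡-Reasoning
    j = suc (suc d) ℕ.+ i
    square : α i j + η i (suc j) ≡ η i j + α (suc i) j
    square = flat (h₁ (suc d) (ℕ.n≤1+n _)) (h₁ (suc (suc d)) ℕ.≤-refl)
      (subst (Distinct (suc i)) (ℕ.+-suc (suc d) i) (h₂ d (ℕ.n≤1+n _)))
      (subst (Distinct (suc i)) (ℕ.+-suc (suc (suc d)) i) (h₂ (suc d) ℕ.≤-refl))

-- Turning of periodic curves that do not close up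

add-right-minus : ∀ i j c → (i + c) - (j + c) ≡ i - j
add-right-minus = solve-∀

left-minus : ∀ i c → (i + c) - i ≡ c
left-minus = solve-∀

module Essential (u t : ℕ → ℤ) (step : ∀ m → Step (u m) (t m) (u (suc m)) (t (suc m)))
  (d : ℕ) (U T : ℤ)
  (u-period : ∀ m → u (m ℕ.+ suc (suc d)) ≡ u m + U)
  (t-period : ∀ m → t (m ℕ.+ suc (suc d)) ≡ t m + T) where

  open Winding u t step

  private
    ℓ : ℕ
    ℓ = suc (suc d)

  α-period : ∀ i j → α (i ℕ.+ ℓ) (j ℕ.+ ℓ) ≡ α i j
  α-period i j
    rewrite u-period i | u-period j | t-period i | t-period j | t-period (suc j)
          | add-right-minus (u j) (u i) U | add-right-minus (t j) (t i) T
          | add-right-minus (t (suc j)) (t i) T = refl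

  C-period : ∀ i n → C (i ℕ.+ ℓ) n ≡ C i n
  C-period i zero    = refl
  C-period i (suc n) = cong₂ _+_ (C-period i n)
    (trans (cong (α (i ℕ.+ ℓ)) (sym (ℕ.+-assoc (suc n) i ℓ))) (α-period i (suc n ℕ.+ i)))

  -- Both moves join the chord of a whole period, which does not depend on its starting point.
  η-α-cancel : ∀ i → η i (i ℕ.+ ℓ) + α (suc i) (i ℕ.+ ℓ) ≡ 0ℤ
  η-α-cancel i with step i
  ... | east-west _ p
    rewrite t-period (suc i) | t-period i | p =
      lemma (neg (u (i ℕ.+ ℓ) - u i)) (neg (u (i ℕ.+ ℓ) - u (suc i))) (pos (t i + T - t i))
    where
    lemma : ∀ a b x → a * (x - x) + b * (x - x) ≡ 0ℤ
    lemma = solve-∀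
  ... | north-south p _
    rewrite p | t-period (suc i) | t-period i
          | left-minus (t i) T | left-minus (t (suc i)) T =
      lemma (neg (u (i ℕ.+ ℓ) - u i)) (pos (t i + T - t (suc i))) (pos T)
    where
    lemma : ∀ a x y → a * (x - y) + a * (y - x) ≡ 0ℤ
    lemma = solve-∀

  -- `C i (suc d)` is the turn from the tangent at `i` to the chord of a whole period. That chord is
  -- the same vector for all `i`, so passing to `suc i` loses exactly `τ i`; after a period `C` is
  -- back at its first value.
  winding≡0 : (∀ i d′ → d′ ℕ.≤ suc d → Distinct i (suc d′ ℕ.+ i)) → ∑ τ ℓ ≡ 0ℤ
  winding≡0 distinct = +-cancelˡ (- C 0 (suc d)) _ _ (begin
    - C 0 (suc d) + ∑ τ ℓ  ≡⟨ ∑-telescope (λ i → - C i (suc d)) τ telescope ℓ ⟨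
    - C ℓ (suc d)          ≡⟨ cong -_ (C-period 0 (suc d)) ⟩
    - C 0 (suc d)          ≡⟨ ℤ.+-identityʳ _ ⟨
    - C 0 (suc d) + 0ℤ     ∎)
    where
    open ≡-Reasoning
    rearrange : ∀ c c′ a e s → c + e ≡ s + c′ → e + a ≡ 0ℤ → - (c′ + a) ≡ - c + s
    rearrange c c′ a e s h k = begin
      - (c′ + a)                            ≡⟨ lemma₁ c′ a s ⟩
      - ((s + c′) + a) + s                  ≡⟨ cong (λ z → - (z + a) + s) h ⟨
      - ((c + e) + a) + s                   ≡⟨ cong (λ z → - z + s) (ℤ.+-assoc c e a) ⟩
      - (c + (e + a)) + s                   ≡⟨ cong (λ z → - (c + z) + s) k ⟩
      - (c + 0ℤ) + s                        ≡⟨ cong (λ z → - z + s) (ℤ.+-identityʳ c) ⟩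
      - c + s                               ∎
      where
      lemma₁ : ∀ c′ a s → - (c′ + a) ≡ - ((s + c′) + a) + s
      lemma₁ = solve-∀
    telescope : ∀ i → - C (suc i) (suc d) ≡ - C i (suc d) + τ i
    telescope i = rearrange (C i (suc d)) (C (suc i) d) (α (suc i) (suc d ℕ.+ suc i))
      (η i (i ℕ.+ ℓ)) (τ i)
      (trans (cong (λ j → C i (suc d) + η i j) (ℕ.+-comm i ℓ))
        (strip i d (distinct i) (λ d′ → distinct (suc i) d′ ∘ ℕ.m≤n⇒m≤1+n)))
      (trans (cong (λ j → η i (i ℕ.+ ℓ) + α (suc i) j) (trans (ℕ.+-suc (suc d) i) (ℕ.+-comm ℓ i)))
        (η-α-cancel i))

-- Turning of simple closed curves

-- The ray u < 0, t = 1/2 lies on the side u < t, so a chord confined to t ≤ u never meets it.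
half⁺ : ∀ {u t u′ t′} → Step u t u′ t′ → t ℤ.≤ u → t′ ℤ.≤ u′ → neg u * (pos t′ - pos t) ≡ 0ℤ
half⁺ {u} {t} (east-west _ refl) _ _ = lemma (neg u) (pos t)
  where
  lemma : ∀ a x → a * (x - x) ≡ 0ℤ
  lemma = solve-∀
half⁺ {+ n}      (north-south refl _) _ _ = refl
half⁺ { -[1+ n ]} (north-south refl _) (-≤- _) (-≤- _) = refl

-- On the side u ≤ t, a step between t = 0 and t = 1 that avoids the origin has u < 0. Every
-- crossing of the line t = 1/2 is then a crossing of the ray, so that the count telescopes.
half⁻ : ∀ {u t u′ t′} → Step u t u′ t′ → u ℤ.≤ t → u′ ℤ.≤ t′ → ¬ Origin u t → ¬ Origin u′ t′ →
  neg u * (pos t′ - pos t) ≡ pos t′ - pos t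
half⁻ {u} {t} (east-west _ refl) _ _ _ _ = lemma (neg u) (pos t)
  where
  lemma : ∀ a x → a * (x - x) ≡ x - x
  lemma = solve-∀
half⁻ { -[1+ n ]} {t} {_} {t′} (north-south refl _) _ _ _ _ = ℤ.*-identityˡ (pos t′ - pos t)
half⁻ {+ n} {t} {_} {t′} (north-south refl t~t′) u≤t u≤t′ o o′ with pos-adjacent t~t′
... | inj₁ e rewrite e = sym (ℤ.+-inverseʳ (pos t′))
... | inj₂ (inj₁ refl) with u≤t
...   | +≤+ ℕ.z≤n = ⊥-elim (o (refl , refl))
half⁻ {+ n} {t} {_} {t′} (north-south refl t~t′) u≤t u≤t′ o o′ | inj₂ (inj₂ refl) with u≤t′
...   | +≤+ ℕ.z≤n = ⊥-elim (o′ (refl , refl))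

-- In rotated coordinates u - t is the doubled abscissa up to a constant, so `min` makes point 0 a
-- leftmost point. Chords leaving it lie in the half-plane of `half⁺`, chords ending at it one
-- period later in that of `half⁻`.
module Contractible (u t : ℕ → ℤ) (step : ∀ m → Step (u m) (t m) (u (suc m)) (t (suc m)))
  (d : ℕ)
  (u-period : ∀ m → u (m ℕ.+ suc (suc (suc d))) ≡ u m)
  (t-period : ∀ m → t (m ℕ.+ suc (suc (suc d))) ≡ t m)
  (min : ∀ m → t m - t 0 ℤ.≤ u m - u 0) where

  open Winding u t step

  private
    ℓ : ℕ
    ℓ = suc (suc (suc d))

  -- Chords spanning a whole period vanish here, so they are excluded.
  Simple : Set
  Simple = ∀ i d′ → d′ ℕ.≤ suc d → Distinct i (suc d′ ℕ.+ i)

  C₀≡0 : ∀ n → C 0 n ≡ 0ℤ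
  C₀≡0 zero    = refl
  C₀≡0 (suc n) = cong₂ _+_ (C₀≡0 n) (half⁺ {u j - u 0} {t j - t 0} from-base (min j) (min (suc j)))
    where
    j = suc n ℕ.+ 0
    from-base : Step (u j - u 0) (t j - t 0) (u (suc j) - u 0) (t (suc j) - t 0)
    from-base with step j
    ... | east-west a p   = east-west (adjacent-minus (u 0) a) (cong (_- t 0) p)
    ... | north-south p a = north-south (cong (_- u 0) p) (adjacent-minus (t 0) a)

  max : ∀ m → u ℓ - u m ℤ.≤ t ℓ - t m
  max m = subst₂ ℤ._≤_ (swap (u m) (u 0) (u ℓ) (u-period 0)) (swap (t m) (t 0) (t ℓ) (t-period 0))
    (ℤ.neg-mono-≤ (min m))
    where
    swap : ∀ a b c → c ≡ b → - (a - b) ≡ c - a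
    swap a b c refl = lemma a b
      where
      lemma : ∀ a b → - (a - b) ≡ b - a
      lemma = solve-∀

  η-to-end : Simple → ∀ i d′ → suc (suc d′) ℕ.+ suc i ≡ ℓ →
    η (suc i) ℓ ≡ pos (t ℓ - t (suc (suc i))) - pos (t ℓ - t (suc i))
  η-to-end simple i d′ eq = half⁻ {u ℓ - u (suc i)} {t ℓ - t (suc i)} to-end
    (max (suc i)) (max (suc (suc i)))
    (subst (Distinct (suc i)) eq (simple (suc i) (suc d′) (ℕ.s≤s d′≤d)))
    (subst (Distinct (suc (suc i))) (trans (ℕ.+-suc (suc d′) (suc i)) eq)
      (simple (suc (suc i)) d′ (ℕ.m≤n⇒m≤1+n d′≤d)))
    where
    d′≤d : d′ ℕ.≤ d
    d′≤d = ℕ.m+n≤o⇒m≤o d′ {i} (ℕ.≤-reflexive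
      (ℕ.suc-injective (ℕ.suc-injective (ℕ.suc-injective (trans (sym (ℕ.+-suc (suc (suc d′)) i)) eq)))))
    to-end : Step (u ℓ - u (suc i)) (t ℓ - t (suc i)) (u ℓ - u (suc (suc i))) (t ℓ - t (suc (suc i)))
    to-end with step (suc i)
    ... | east-west a p   = east-west (minus-adjacent (u ℓ) a) (cong (λ z → t ℓ - z) p)
    ... | north-south p a = north-south (cong (λ z → u ℓ - z) p) (minus-adjacent (t ℓ) a)

  -- The part of Hopf's triangle with base index at least 1: each `strip` moves the base on by one,
  -- and the moves along the side of chords ending at `ℓ` telescope.
  triangle : Simple → ∀ n e → e ℕ.+ n ≡ suc d →
    ∑ (τ ∘ suc) n + C (suc n) e ≡
    C 1 (suc d) + (pos (t ℓ - t (suc n)) - pos (t ℓ - t 1))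
  triangle simple zero    e eq = begin
    0ℤ + C 1 e                                  ≡⟨ ℤ.+-identityˡ _ ⟩
    C 1 e                                       ≡⟨ cong (C 1) (trans (sym (ℕ.+-identityʳ e)) eq) ⟩
    C 1 (suc d)                                 ≡⟨ lemma (C 1 (suc d)) (pos (t ℓ - t 1)) ⟩
    C 1 (suc d) + (pos (t ℓ - t 1) - pos (t ℓ - t 1)) ∎
    where
    open ≡-Reasoning
    lemma : ∀ c x → c ≡ c + (x - x)
    lemma = solve-∀
  triangle simple (suc n) e eq = begin
    (∑ (τ ∘ suc) n + τ (suc n)) + C (suc (suc n)) e ≡⟨ ℤ.+-assoc (∑ (τ ∘ suc) n) _ _ ⟩
    ∑ (τ ∘ suc) n + (τ (suc n) + C (suc (suc n)) e)
      ≡⟨ cong (λ z → ∑ (τ ∘ suc) n + z) (sym (strip (suc n) e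
          (λ d′ d′≤ → simple (suc n) d′ (ℕ.≤-trans d′≤ (ℕ.s≤s e≤d)))
          (λ d′ d′≤ → simple (suc (suc n)) d′ (ℕ.≤-trans d′≤ (ℕ.m≤n⇒m≤1+n e≤d))))) ⟩
    ∑ (τ ∘ suc) n + (C (suc n) (suc e) + η (suc n) (suc (suc e) ℕ.+ suc n))
      ≡⟨ ℤ.+-assoc (∑ (τ ∘ suc) n) _ _ ⟨
    (∑ (τ ∘ suc) n + C (suc n) (suc e)) + η (suc n) (suc (suc e) ℕ.+ suc n)
      ≡⟨ cong₂ _+_ (triangle simple n (suc e) (trans (sym (ℕ.+-suc e n)) eq))
          (trans (cong (η (suc n)) end) (η-to-end simple n e end)) ⟩
    (C 1 (suc d) + (pos (t ℓ - t (suc n)) - pos (t ℓ - t 1)))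
      + (pos (t ℓ - t (suc (suc n))) - pos (t ℓ - t (suc n)))
      ≡⟨ lemma (C 1 (suc d)) (pos (t ℓ - t 1)) (pos (t ℓ - t (suc n))) (pos (t ℓ - t (suc (suc n)))) ⟩
    C 1 (suc d) + (pos (t ℓ - t (suc (suc n))) - pos (t ℓ - t 1)) ∎
    where
    open ≡-Reasoning
    end : suc (suc e) ℕ.+ suc n ≡ ℓ
    end = cong (λ m → suc (suc m)) eq
    e≤d : e ℕ.≤ d
    e≤d = ℕ.m+n≤o⇒m≤o e {n} (ℕ.≤-reflexive (ℕ.suc-injective (trans (sym (ℕ.+-suc e n)) eq)))
    lemma : ∀ c a b b′ → (c + (b - a)) + (b′ - b) ≡ c + (b′ - a)
    lemma = solve-∀

  -- The corner (0, `ℓ`) of Hopf's triangle is a zero chord and has to be cut off. The chords go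
  -- from (0, `ℓ` - 1) through (1, `ℓ` - 1) to (1, `ℓ`), which gives the bracketed terms; the side
  -- based at 0 contributes nothing, the side ending at `ℓ` a difference of `pos`. Only the last
  -- turn of the period is still missing.
  winding-from-base : Simple →
    ∑ τ (suc (suc d)) ≡ (η 0 (suc (suc d)) + α 1 (suc (suc d)))
                        + (pos (t ℓ - t (suc (suc d))) - pos (t ℓ - t 1))
  winding-from-base simple = begin
    ∑ τ (suc (suc d))              ≡⟨ ∑-head τ (suc d) ⟨
    τ 0 + ∑ (τ ∘ suc) (suc d)      ≡⟨ cong (λ z → τ 0 + z) (ℤ.+-identityʳ _) ⟨
    τ 0 + (∑ (τ ∘ suc) (suc d) + 0ℤ) ≡⟨ cong (λ z → τ 0 + z) (triangle simple (suc d) 0 refl) ⟩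
    τ 0 + ((C 1 d + α 1 (suc d ℕ.+ 1)) + last)
      ≡⟨ lemma (τ 0) (C 1 d) _ last ⟩
    (τ 0 + C 1 d) + (α 1 (suc d ℕ.+ 1) + last)
      ≡⟨ cong₂ _+_ first (cong (λ j → α 1 (suc j) + last) (ℕ.+-comm d 1)) ⟩
    η 0 (suc (suc d)) + (α 1 (suc (suc d)) + last) ≡⟨ ℤ.+-assoc (η 0 (suc (suc d))) _ _ ⟨
    (η 0 (suc (suc d)) + α 1 (suc (suc d))) + last ∎
    where
    open ≡-Reasoning
    last : ℤ
    last = pos (t ℓ - t (suc (suc d))) - pos (t ℓ - t 1)
    lemma : ∀ a b c l → a + ((b + c) + l) ≡ (a + b) + (c + l)
    lemma = solve-∀
    first : τ 0 + C 1 d ≡ η 0 (suc (suc d))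
    first = trans (sym (strip 0 d (simple 0) (λ d′ d′≤ → simple 1 d′ (ℕ.m≤n⇒m≤1+n d′≤))))
      (trans (cong₂ (λ c j → c + η 0 (suc (suc j))) (C₀≡0 (suc d)) (ℕ.+-identityʳ d))
        (ℤ.+-identityˡ _))

-- Diagonal walks and their steps with X = Y = -1

⟦_⟧ : Sign → ℤ
⟦ Sign.+ ⟧ = 1ℤ
⟦ Sign.- ⟧ = -1ℤ

-- For a step (X, Y) these are (X + Y)/2, (Y - X)/2 and (1 - X)(1 - Y)/4, tabulated so that no
-- division occurs.
δu δt σ : Sign → Sign → ℤ
δu Sign.+ Sign.+ = 1ℤ
δu Sign.- Sign.- = -1ℤ
δu _      _      = 0ℤ
δt Sign.- Sign.+ = 1ℤ
δt Sign.+ Sign.- = -1ℤ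
δt _      _      = 0ℤ
σ Sign.- Sign.- = 1ℤ
σ _      _      = 0ℤ

δu-δt : ∀ s s′ → δu s s′ - δt s s′ ≡ ⟦ s ⟧
δu-δt Sign.+ Sign.+ = refl
δu-δt Sign.+ Sign.- = refl
δu-δt Sign.- Sign.+ = refl
δu-δt Sign.- Sign.- = refl

δu+δt : ∀ s s′ → δu s s′ + δt s s′ ≡ ⟦ s′ ⟧
δu+δt Sign.+ Sign.+ = refl
δu+δt Sign.+ Sign.- = refl
δu+δt Sign.- Sign.+ = refl
δu+δt Sign.- Sign.- = refl

4σ : ∀ s s′ → + 4 * σ s s′ ≡ 1ℤ - ⟦ s ⟧ - ⟦ s′ ⟧ + ⟦ s ⟧ * ⟦ s′ ⟧
4σ Sign.+ Sign.+ = refl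
4σ Sign.+ Sign.- = refl
4σ Sign.- Sign.+ = refl
4σ Sign.- Sign.- = refl

turn-τ : (x y x′ y′ : Sign) → ℤ
turn-τ x y x′ y′ =
  neg (δu x y) * (pos (δt x y + δt x′ y′) - pos (δt x y))
  + neg (δu x y + δu x′ y′) * (pos (δt x′ y′) - pos (δt x y + δt x′ y′))

turn-x : ∀ x y y′ → turn-τ x y x y′ ≡ σ x y - σ x y′
turn-x Sign.+ Sign.+ Sign.+ = refl
turn-x Sign.+ Sign.+ Sign.- = refl
turn-x Sign.+ Sign.- Sign.+ = refl
turn-x Sign.+ Sign.- Sign.- = refl
turn-x Sign.- Sign.+ Sign.+ = refl
turn-x Sign.- Sign.+ Sign.- = refl
turn-x Sign.- Sign.- Sign.+ = refl
turn-x Sign.- Sign.- Sign.- = refl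

turn-y : ∀ x y x′ → turn-τ x y x′ y ≡ 0ℤ
turn-y Sign.+ Sign.+ Sign.+ = refl
turn-y Sign.+ Sign.+ Sign.- = refl
turn-y Sign.+ Sign.- Sign.+ = refl
turn-y Sign.+ Sign.- Sign.- = refl
turn-y Sign.- Sign.+ Sign.+ = refl
turn-y Sign.- Sign.+ Sign.- = refl
turn-y Sign.- Sign.- Sign.+ = refl
turn-y Sign.- Sign.- Sign.- = refl

argmin : (f : ℕ → ℤ) → ∀ n → ∃[ o ] (∀ m → m ℕ.< suc n → f o ℤ.≤ f m)
argmin f zero    = 0 , λ where zero _ → ℤ.≤-refl
                               (suc m) (ℕ.s≤s ())
argmin f (suc n) with argmin f n
... | o , min with ℤ.≤-total (f o) (f (suc n))
... | inj₁ fo≤ = o , λ m m< → case-last m m<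
  where
  case-last : ∀ m → m ℕ.< suc (suc n) → f o ℤ.≤ f m
  case-last m (ℕ.s≤s m≤) with ℕ.m≤n⇒m<n∨m≡n m≤
  ... | inj₁ m<   = min m m<
  ... | inj₂ refl = fo≤
... | inj₂ ≤fo = suc n , λ m m< → case-last m m<
  where
  case-last : ∀ m → m ℕ.< suc (suc n) → f (suc n) ℤ.≤ f m
  case-last m (ℕ.s≤s m≤) with ℕ.m≤n⇒m<n∨m≡n m≤
  ... | inj₁ m<   = ℤ.≤-trans ≤fo (min m m<)
  ... | inj₂ refl = ℤ.≤-refl

periodic-min : (f : ℕ → ℤ) → ∀ n → (∀ m → f (m ℕ.+ suc n) ≡ f m) → ∃[ o ] (∀ m → f o ℤ.≤ f m)
periodic-min f n per with argmin f n
... | o , min = o , λ m → subst (f o ℤ.≤_) (sym (reduce m)) (min _ (ℕ.m%n<n m (suc n)))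
  where
  wrap : ∀ r q → f (r ℕ.+ q ℕ.* suc n) ≡ f r
  wrap r zero    = cong f (ℕ.+-identityʳ r)
  wrap r (suc q) = trans (cong f (trans (cong (r ℕ.+_) (ℕ.+-comm (suc n) (q ℕ.* suc n)))
                                        (sym (ℕ.+-assoc r _ _))))
                         (trans (per _) (wrap r q))
  reduce : ∀ m → f m ≡ f (m ℕ.% suc n)
  reduce m = trans (cong f (ℕ.m≡m%n+[m/n]*n m (suc n))) (wrap (m ℕ.% suc n) (m ℕ./ suc n))

double≡0 : ∀ z → z + z ≡ 0ℤ → z ≡ 0ℤ
double≡0 (+ zero) _ = refl

-- a and b are the doubled coordinates of the midpoints of the edges of a lifted loop, and v m is 1 if the
-- m-th edge is horizontal and 0 if it is vertical.
record Walk (ℓ : ℕ) : Set where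
  field
    X Y    : ℕ → Sign
    a b v  : ℕ → ℤ
    a-step : ∀ m → a (suc m) ≡ a m + ⟦ X m ⟧
    b-step : ∀ m → b (suc m) ≡ b m + ⟦ Y m ⟧
    turn   : ∀ m → (v m ≡ 0ℤ × v (suc m) ≡ 1ℤ × X m ≡ X (suc m))
                 ⊎ (v m ≡ 1ℤ × v (suc m) ≡ 0ℤ × Y m ≡ Y (suc m))
    X-period : ∀ m → X (m ℕ.+ ℓ) ≡ X m
    Y-period : ∀ m → Y (m ℕ.+ ℓ) ≡ Y m
    v-period : ∀ m → v (m ℕ.+ ℓ) ≡ v m
    simple : ∀ i d → suc d ℕ.< ℓ → ¬ (a i ≡ a (suc d ℕ.+ i) × b i ≡ b (suc d ℕ.+ i))

module WalkProperties {ℓ : ℕ} (W : Walk ℓ) where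
  open Walk W

  -- (a, b) rotated by 45°, so that the diagonal steps become unit steps.
  u t : ℕ → ℤ
  u zero    = 0ℤ
  u (suc m) = u m + δu (X m) (Y m)
  t zero    = 0ℤ
  t (suc m) = t m + δt (X m) (Y m)

  a-rotated : ∀ m → a m ≡ a 0 + (u m - t m)
  a-rotated zero    = sym (ℤ.+-identityʳ (a 0))
  a-rotated (suc m) = begin
    a (suc m)                                       ≡⟨ a-step m ⟩
    a m + ⟦ X m ⟧                                   ≡⟨ cong₂ _+_ (a-rotated m) (sym (δu-δt (X m) (Y m))) ⟩
    (a 0 + (u m - t m)) + (δu (X m) (Y m) - δt (X m) (Y m)) ≡⟨ lemma (a 0) (u m) (t m) _ _ ⟩
    a 0 + (u (suc m) - t (suc m))                   ∎
    where
    open ≡-Reasoning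
    lemma : ∀ a u t p q → (a + (u - t)) + (p - q) ≡ a + ((u + p) - (t + q))
    lemma = solve-∀

  b-rotated : ∀ m → b m ≡ b 0 + (u m + t m)
  b-rotated zero    = sym (ℤ.+-identityʳ (b 0))
  b-rotated (suc m) = begin
    b (suc m)                                       ≡⟨ b-step m ⟩
    b m + ⟦ Y m ⟧                                   ≡⟨ cong₂ _+_ (b-rotated m) (sym (δu+δt (X m) (Y m))) ⟩
    (b 0 + (u m + t m)) + (δu (X m) (Y m) + δt (X m) (Y m)) ≡⟨ lemma (b 0) (u m) (t m) _ _ ⟩
    b 0 + (u (suc m) + t (suc m))                   ∎
    where
    open ≡-Reasoning
    lemma : ∀ a u t p q → (a + (u + t)) + (p + q) ≡ a + ((u + p) + (t + q))
    lemma = solve-∀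

  step : ∀ m → Step (u m) (t m) (u (suc m)) (t (suc m))
  step m with X m | Y m
  ... | Sign.+ | Sign.+ = east-west (up refl) (ℤ.+-identityʳ _)
  ... | Sign.- | Sign.- = east-west (down refl) (ℤ.+-identityʳ _)
  ... | Sign.- | Sign.+ = north-south (ℤ.+-identityʳ _) (up refl)
  ... | Sign.+ | Sign.- = north-south (ℤ.+-identityʳ _) (down refl)

  open Winding u t step

  u-period : ∀ m → u (m ℕ.+ ℓ) ≡ u m + u ℓ
  u-period zero    = sym (ℤ.+-identityˡ (u ℓ))
  u-period (suc m) = trans (cong₂ _+_ (u-period m) (cong₂ δu (X-period m) (Y-period m)))
    (lemma (u m) (u ℓ) _)
    where
    lemma : ∀ x y z → (x + y) + z ≡ (x + z) + y
    lemma = solve-∀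

  t-period : ∀ m → t (m ℕ.+ ℓ) ≡ t m + t ℓ
  t-period zero    = sym (ℤ.+-identityˡ (t ℓ))
  t-period (suc m) = trans (cong₂ _+_ (t-period m) (cong₂ δt (X-period m) (Y-period m)))
    (lemma (t m) (t ℓ) _)
    where
    lemma : ∀ x y z → (x + y) + z ≡ (x + z) + y
    lemma = solve-∀

  a-period : ∀ m → a (m ℕ.+ ℓ) ≡ a m + (a ℓ - a 0)
  a-period m = begin
    a (m ℕ.+ ℓ)                                      ≡⟨ a-rotated (m ℕ.+ ℓ) ⟩
    a 0 + (u (m ℕ.+ ℓ) - t (m ℕ.+ ℓ))                ≡⟨ cong₂ (λ y z → a 0 + (y - z)) (u-period m) (t-period m) ⟩
    a 0 + ((u m + u ℓ) - (t m + t ℓ))                ≡⟨ lemma (a 0) (u m) (t m) (u ℓ) (t ℓ) ⟩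
    (a 0 + (u m - t m)) + ((a 0 + (u ℓ - t ℓ)) - a 0) ≡⟨ cong₂ (λ y z → y + (z - a 0)) (a-rotated m) (a-rotated ℓ) ⟨
    a m + (a ℓ - a 0)                                ∎
    where
    open ≡-Reasoning
    lemma : ∀ a u t u′ t′ → a + ((u + u′) - (t + t′)) ≡ (a + (u - t)) + ((a + (u′ - t′)) - a)
    lemma = solve-∀

  b-period : ∀ m → b (m ℕ.+ ℓ) ≡ b m + (b ℓ - b 0)
  b-period m = begin
    b (m ℕ.+ ℓ)                                      ≡⟨ b-rotated (m ℕ.+ ℓ) ⟩
    b 0 + (u (m ℕ.+ ℓ) + t (m ℕ.+ ℓ))                ≡⟨ cong₂ (λ y z → b 0 + (y + z)) (u-period m) (t-period m) ⟩
    b 0 + ((u m + u ℓ) + (t m + t ℓ))                ≡⟨ lemma (b 0) (u m) (t m) (u ℓ) (t ℓ) ⟩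
    (b 0 + (u m + t m)) + ((b 0 + (u ℓ + t ℓ)) - b 0) ≡⟨ cong₂ (λ y z → y + (z - b 0)) (b-rotated m) (b-rotated ℓ) ⟨
    b m + (b ℓ - b 0)                                ∎
    where
    open ≡-Reasoning
    lemma : ∀ a u t u′ t′ → a + ((u + u′) + (t + t′)) ≡ (a + (u + t)) + ((a + (u′ + t′)) - a)
    lemma = solve-∀

  distinct : ∀ i j → ¬ (a i ≡ a j × b i ≡ b j) → Distinct i j
  distinct i j apart (p , q) = apart
    ( trans (a-rotated i) (trans (cong₂ (λ y z → a 0 + (y - z)) uᵢ≡uⱼ tᵢ≡tⱼ) (sym (a-rotated j)))
    , trans (b-rotated i) (trans (cong₂ (λ y z → b 0 + (y + z)) uᵢ≡uⱼ tᵢ≡tⱼ) (sym (b-rotated j))))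
    where
    uᵢ≡uⱼ = sym (ℤ.i-j≡0⇒i≡j (u j) (u i) p)
    tᵢ≡tⱼ = sym (ℤ.i-j≡0⇒i≡j (t j) (t i) q)

  s : ℕ → ℤ
  s m = σ (X m) (Y m)

  τ-signs : ∀ i → τ i ≡ turn-τ (X i) (Y i) (X (suc i)) (Y (suc i))
  τ-signs i
    rewrite left-minus (u i) (δu (X i) (Y i)) | left-minus (t i) (δt (X i) (Y i))
          | left-minus (t i + δt (X i) (Y i)) (δt (X (suc i)) (Y (suc i)))
          | ℤ.+-assoc (t i) (δt (X i) (Y i)) (δt (X (suc i)) (Y (suc i)))
          | left-minus (t i) (δt (X i) (Y i) + δt (X (suc i)) (Y (suc i)))
          | ℤ.+-assoc (u i) (δu (X i) (Y i)) (δu (X (suc i)) (Y (suc i)))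
          | left-minus (u i) (δu (X i) (Y i) + δu (X (suc i)) (Y (suc i))) = refl

  -- A turn onto a horizontal edge has `τ i ≡ s i - s (suc i)`, a turn onto a vertical one has
  -- `τ i ≡ 0`; the switch `v` merges both into one equation. Over a period its two `v`-terms have
  -- the same sum, hence the even correction in `∑s`.
  s≡τ+ : ∀ i → s i ≡ τ i + v i * s i + v (suc i) * s (suc i)
  s≡τ+ i with turn i
  ... | inj₁ (p , q , x) = sym (begin
    τ i + v i * s i + v (suc i) * s (suc i)
      ≡⟨ cong₂ (λ w z → z + w * s i + v (suc i) * s (suc i)) p
           (trans (τ-signs i) (cong (λ x′ → turn-τ (X i) (Y i) x′ (Y (suc i))) (sym x))) ⟩
    turn-τ (X i) (Y i) (X i) (Y (suc i)) + 0ℤ * s i + v (suc i) * s (suc i)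
      ≡⟨ cong₂ (λ w z → z + 0ℤ * s i + w * s (suc i)) q (turn-x (X i) (Y i) (Y (suc i))) ⟩
    s i - σ (X i) (Y (suc i)) + 0ℤ * s i + 1ℤ * s (suc i)
      ≡⟨ cong (λ x′ → s i - σ x′ (Y (suc i)) + 0ℤ * s i + 1ℤ * s (suc i)) x ⟩
    s i - s (suc i) + 0ℤ * s i + 1ℤ * s (suc i)  ≡⟨ lemma (s i) (s (suc i)) ⟩
    s i ∎)
    where
    open ≡-Reasoning
    lemma : ∀ x y → x - y + 0ℤ * x + 1ℤ * y ≡ x
    lemma = solve-∀
  ... | inj₂ (p , q , y) = sym (begin
    τ i + v i * s i + v (suc i) * s (suc i)
      ≡⟨ cong₂ (λ w z → z + w * s i + v (suc i) * s (suc i)) p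
           (trans (τ-signs i) (cong (turn-τ (X i) (Y i) (X (suc i))) (sym y))) ⟩
    turn-τ (X i) (Y i) (X (suc i)) (Y i) + 1ℤ * s i + v (suc i) * s (suc i)
      ≡⟨ cong₂ (λ w z → z + 1ℤ * s i + w * s (suc i)) q (turn-y (X i) (Y i) (X (suc i))) ⟩
    0ℤ + 1ℤ * s i + 0ℤ * s (suc i)  ≡⟨ lemma (s i) (s (suc i)) ⟩
    s i ∎)
    where
    open ≡-Reasoning
    lemma : ∀ x y → 0ℤ + 1ℤ * x + 0ℤ * y ≡ x
    lemma = solve-∀

  s-period : ∀ m → s (m ℕ.+ ℓ) ≡ s m
  s-period m = cong₂ σ (X-period m) (Y-period m)

  τ-period : ∀ m → τ (m ℕ.+ ℓ) ≡ τ m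
  τ-period m = trans (τ-signs (m ℕ.+ ℓ))
    (trans (cong₂ (λ (x , y) (x′ , y′) → turn-τ x y x′ y′)
        (cong₂ _,_ (X-period m) (Y-period m)) (cong₂ _,_ (X-period (suc m)) (Y-period (suc m))))
      (sym (τ-signs m)))

  ∑s : ∑ s ℓ ≡ ∑ τ ℓ + + 2 * ∑ (λ i → v i * s i) ℓ
  ∑s = begin
    ∑ s ℓ                                 ≡⟨ split ℓ ⟩
    ∑ τ ℓ + ∑ f ℓ + ∑ (f ∘ suc) ℓ
      ≡⟨ cong (λ z → ∑ τ ℓ + ∑ f ℓ + z) (∑-rotate f ℓ (cong₂ _*_ (v-period 0) (s-period 0))) ⟩
    ∑ τ ℓ + ∑ f ℓ + ∑ f ℓ                 ≡⟨ lemma (∑ τ ℓ) (∑ f ℓ) ⟩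
    ∑ τ ℓ + + 2 * ∑ f ℓ                   ∎
    where
    open ≡-Reasoning
    f : ℕ → ℤ
    f i = v i * s i
    lemma : ∀ x y → x + y + y ≡ x + + 2 * y
    lemma = solve-∀
    regroup : ∀ a b c a′ b′ c′ → (a + b + c) + (a′ + b′ + c′) ≡ (a + a′) + (b + b′) + (c + c′)
    regroup = solve-∀
    split : ∀ n → ∑ s n ≡ ∑ τ n + ∑ f n + ∑ (f ∘ suc) n
    split zero    = refl
    split (suc n) = trans (cong₂ _+_ (split n) (s≡τ+ n))
      (regroup (∑ τ n) (∑ f n) (∑ (f ∘ suc) n) (τ n) (f n) (f (suc n)))

  length-formula : (h : ℕ → ℤ) → (∀ m → h (suc m) ≡ h m + ⟦ X m ⟧ * ⟦ Y m ⟧) →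
    + ℓ ≡ (a ℓ - a 0) + (b ℓ - b 0) - (h ℓ - h 0) + + 4 * ∑ s ℓ
  length-formula h h-step = begin
    + ℓ  ≡⟨ lemma₁ (+ ℓ) (a ℓ) (b ℓ) (h ℓ) ⟩
    (+ ℓ - a ℓ - b ℓ + h ℓ) + (a ℓ + b ℓ - h ℓ)
      ≡⟨ cong (λ z → z + (a ℓ + b ℓ - h ℓ)) (∑-telescope (λ m → + m - a m - b m + h m) (λ m → + 4 * s m) P-step ℓ) ⟩
    ((0ℤ - a 0 - b 0 + h 0) + ∑ (λ m → + 4 * s m) ℓ) + (a ℓ + b ℓ - h ℓ)
      ≡⟨ cong (λ z → ((0ℤ - a 0 - b 0 + h 0) + z) + (a ℓ + b ℓ - h ℓ)) (∑-4 ℓ) ⟩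
    ((0ℤ - a 0 - b 0 + h 0) + + 4 * ∑ s ℓ) + (a ℓ + b ℓ - h ℓ)
      ≡⟨ lemma₂ (a 0) (b 0) (h 0) (a ℓ) (b ℓ) (h ℓ) (∑ s ℓ) ⟩
    (a ℓ - a 0) + (b ℓ - b 0) - (h ℓ - h 0) + + 4 * ∑ s ℓ ∎
    where
    open ≡-Reasoning
    lemma₁ : ∀ l a b h → l ≡ (l - a - b + h) + (a + b - h)
    lemma₁ = solve-∀
    lemma₂ : ∀ a₀ b₀ h₀ a b h s → ((0ℤ - a₀ - b₀ + h₀) + + 4 * s) + (a + b - h)
                                  ≡ (a - a₀) + (b - b₀) - (h - h₀) + + 4 * s
    lemma₂ = solve-∀
    ∑-4 : ∀ n → ∑ (λ m → + 4 * s m) n ≡ + 4 * ∑ s n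
    ∑-4 zero    = refl
    ∑-4 (suc n) = trans (cong (_+ + 4 * s n) (∑-4 n)) (sym (ℤ.*-distribˡ-+ (+ 4) (∑ s n) (s n)))
    lemma₃ : ∀ l a b h x y → (1ℤ + l) - (a + x) - (b + y) + (h + x * y)
                             ≡ (l - a - b + h) + (1ℤ - x - y + x * y)
    lemma₃ = solve-∀
    P-step : ∀ m → + suc m - a (suc m) - b (suc m) + h (suc m) ≡ (+ m - a m - b m + h m) + + 4 * s m
    P-step m rewrite a-step m | b-step m | h-step m | 4σ (X m) (Y m) =
      lemma₃ (+ m) (a m) (b m) (h m) ⟦ X m ⟧ ⟦ Y m ⟧

-- Turning numbers of diagonal walks

module _ {d : ℕ} (W : Walk (suc (suc d))) where
  open Walk W
  open WalkProperties W
  open Winding u t step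

  private
    ℓ : ℕ
    ℓ = suc (suc d)

  essential-winding : ¬ (a ℓ ≡ a 0 × b ℓ ≡ b 0) → ∑ τ ℓ ≡ 0ℤ
  essential-winding essential = Essential.winding≡0 u t step d (u ℓ) (t ℓ) u-period t-period λ i d′ d′≤ →
    distinct i (suc d′ ℕ.+ i) (apart i d′ (ℕ.m≤n⇒m<n∨m≡n d′≤))
    where
    closing : ∀ z z′ c → z ≡ z + (c - z′) → c ≡ z′
    closing z z′ c eq = ℤ.i-j≡0⇒i≡j c z′
      (sym (+-cancelˡ z _ _ (trans (ℤ.+-identityʳ z) eq)))
    apart : ∀ i d′ → d′ ℕ.< suc d ⊎ d′ ≡ suc d → ¬ (a i ≡ a (suc d′ ℕ.+ i) × b i ≡ b (suc d′ ℕ.+ i))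
    apart i d′ (inj₁ d′<) = simple i d′ (ℕ.s≤s d′<)
    -- The offset of a whole period is beyond the range of `simple`; if that chord vanished, the
    -- walk would close up.
    apart i d′ (inj₂ refl) (p , q) = essential
      ( closing (a i) (a 0) (a ℓ) (trans p (trans (cong a (ℕ.+-comm ℓ i)) (a-period i)))
      , closing (b i) (b 0) (b ℓ) (trans q (trans (cong b (ℕ.+-comm ℓ i)) (b-period i))))

module _ {ℓ : ℕ} (W : Walk ℓ) where
  open Walk W
  open WalkProperties W

  closed-u : a ℓ ≡ a 0 → b ℓ ≡ b 0 → u ℓ ≡ 0ℤ × t ℓ ≡ 0ℤ
  closed-u p q = u≡0 , trans (sym (ℤ.i-j≡0⇒i≡j (u ℓ) (t ℓ) diff)) u≡0
    where
    cancel : ∀ z w → z ≡ z + w → w ≡ 0ℤ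
    cancel z w eq = +-cancelˡ z w 0ℤ (trans (sym eq) (sym (ℤ.+-identityʳ z)))
    diff : u ℓ - t ℓ ≡ 0ℤ
    diff = cancel (a 0) _ (trans (sym p) (a-rotated ℓ))
    total : u ℓ + t ℓ ≡ 0ℤ
    total = cancel (b 0) _ (trans (sym q) (b-rotated ℓ))
    lemma : ∀ u t → u + u ≡ (u - t) + (u + t)
    lemma = solve-∀
    u≡0 : u ℓ ≡ 0ℤ
    u≡0 = double≡0 (u ℓ) (trans (lemma (u ℓ) (t ℓ)) (cong₂ _+_ diff total))

left-step : ∀ z s → z + ⟦ s ⟧ ℤ.≤ z → s ≡ Sign.-
left-step z Sign.- _ = refl
left-step z Sign.+ h = ⊥-elim (ℤ.<⇒≱ (ℤ.suc[i]≤j⇒i<j (ℤ.≤-reflexive (ℤ.+-comm 1ℤ z))) h)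

right-step : ∀ z s → z ℤ.≤ z + ⟦ s ⟧ → s ≡ Sign.+
right-step z Sign.+ _ = refl
right-step z Sign.- h = ⊥-elim (ℤ.<⇒≱ (ℤ.i≤pred[j]⇒i<j (ℤ.≤-reflexive (ℤ.+-comm z -1ℤ))) h)

module _ {d : ℕ} (W : Walk (suc (suc (suc d))))
  (aℓ≡a₀ : Walk.a W (suc (suc (suc d))) ≡ Walk.a W 0)
  (bℓ≡b₀ : Walk.b W (suc (suc (suc d))) ≡ Walk.b W 0) where
  open Walk W
  open WalkProperties W

  private
    ℓ : ℕ
    ℓ = suc (suc (suc d))

  private
    a-cycle : ∀ m → a (m ℕ.+ ℓ) ≡ a m
    a-cycle m = trans (a-period m) (trans (cong (λ z → a m + z) (ℤ.i≡j⇒i-j≡0 aℓ≡a₀)) (ℤ.+-identityʳ (a m)))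
    u-cycle : ∀ m → u (m ℕ.+ ℓ) ≡ u m
    u-cycle m = trans (u-period m) (trans (cong (λ z → u m + z) (proj₁ (closed-u W aℓ≡a₀ bℓ≡b₀))) (ℤ.+-identityʳ (u m)))
    t-cycle : ∀ m → t (m ℕ.+ ℓ) ≡ t m
    t-cycle m = trans (t-period m) (trans (cong (λ z → t m + z) (proj₂ (closed-u W aℓ≡a₀ bℓ≡b₀))) (ℤ.+-identityʳ (t m)))
    o : ℕ
    o = proj₁ (periodic-min a (suc (suc d)) a-cycle)
    a-min : ∀ m → a o ℤ.≤ a m
    a-min = proj₂ (periodic-min a (suc (suc d)) a-cycle)
    ℓ-1 : ℕ
    ℓ-1 = suc (suc d)
    wrap : ∀ {A : Set} (f : ℕ → A) → (∀ m → f (m ℕ.+ ℓ) ≡ f m) → ∀ m → f (ℓ ℕ.+ m) ≡ f m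
    wrap f per m = trans (cong f (ℕ.+-comm ℓ m)) (per m)

    first : X o ≡ Sign.+
    first = right-step (a o) (X o) (subst (a o ℤ.≤_) (a-step o) (a-min (suc o)))
    last : X (ℓ-1 ℕ.+ o) ≡ Sign.-
    last = left-step (a (ℓ-1 ℕ.+ o)) _
      (subst (ℤ._≤ a (ℓ-1 ℕ.+ o)) (trans (sym (wrap a a-cycle o)) (a-step (ℓ-1 ℕ.+ o))) (a-min (ℓ-1 ℕ.+ o)))
    -- X reverses at the leftmost point, so the turn there is one of those that keep Y. This leaves
    -- the neighbourhood of that point with the single parameter `Y o`.
    straight : Y (ℓ-1 ℕ.+ o) ≡ Y o
    straight with turn (ℓ-1 ℕ.+ o)
    ... | inj₂ (_ , _ , y) = trans y (wrap Y Y-period o)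
    ... | inj₁ (_ , _ , x) with trans (sym last) (trans x (trans (wrap X X-period o) first))
    ...   | ()

    u′ t′ : ℕ → ℤ
    u′ m = u (m ℕ.+ o)
    t′ m = t (m ℕ.+ o)
    rotated-cycle : (f : ℕ → ℤ) → (∀ m → f (m ℕ.+ ℓ) ≡ f m) → ∀ m → f (m ℕ.+ ℓ ℕ.+ o) ≡ f (m ℕ.+ o)
    rotated-cycle f per m = trans (cong f (trans (ℕ.+-assoc m ℓ o)
        (trans (cong (m ℕ.+_) (ℕ.+-comm ℓ o)) (sym (ℕ.+-assoc m o ℓ)))))
      (per (m ℕ.+ o))
    min : ∀ m → t′ m - t′ 0 ℤ.≤ u′ m - u′ 0
    min m = ℤ.0≤i-j⇒j≤i (subst (0ℤ ℤ.≤_) (begin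
      a (m ℕ.+ o) - a o  ≡⟨ cong₂ _-_ (a-rotated (m ℕ.+ o)) (a-rotated o) ⟩
      (a 0 + (u′ m - t′ m)) - (a 0 + (u′ 0 - t′ 0)) ≡⟨ lemma (a 0) (u′ m) (t′ m) (u′ 0) (t′ 0) ⟩
      (u′ m - u′ 0) - (t′ m - t′ 0) ∎) (ℤ.i≤j⇒0≤j-i (a-min (m ℕ.+ o))))
      where
      open ≡-Reasoning
      lemma : ∀ a u t u₀ t₀ → (a + (u - t)) - (a + (u₀ - t₀)) ≡ (u - u₀) - (t - t₀)
      lemma = solve-∀

    open Contractible u′ t′ (λ m → step (m ℕ.+ o)) d (rotated-cycle u u-cycle) (rotated-cycle t t-cycle) min
    open Winding u′ t′ (λ m → step (m ℕ.+ o))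

    simple′ : Simple
    simple′ i d′ d′≤ = subst (WindingDistinct (i ℕ.+ o)) (sym (ℕ.+-assoc (suc d′) i o))
      (distinct (i ℕ.+ o) _ (simple (i ℕ.+ o) d′ (ℕ.s≤s (ℕ.s≤s d′≤))))
      where
      WindingDistinct = Winding.Distinct u t step

    u₁ : u′ 1 ≡ u′ 0 + δu Sign.+ (Y o)
    u₁ = cong (λ x → u o + δu x (Y o)) first
    t₁ : t′ 1 ≡ t′ 0 + δt Sign.+ (Y o)
    t₁ = cong (λ x → t o + δt x (Y o)) first
    unstep : ∀ z w δ → z ≡ w + δ → w ≡ z - δ
    unstep z w δ refl = lemma w δ
      where
      lemma : ∀ w δ → w ≡ (w + δ) - δ
      lemma = solve-∀
    uℓ-1 : u′ ℓ-1 ≡ u′ 0 - δu Sign.- (Y o)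
    uℓ-1 = unstep (u′ 0) (u′ ℓ-1) _ (trans (sym (wrap u u-cycle o))
      (cong₂ (λ x y → u (ℓ-1 ℕ.+ o) + δu x y) last straight))
    tℓ-1 : t′ ℓ-1 ≡ t′ 0 - δt Sign.- (Y o)
    tℓ-1 = unstep (t′ 0) (t′ ℓ-1) _ (trans (sym (wrap t t-cycle o))
      (cong₂ (λ x y → t (ℓ-1 ℕ.+ o) + δt x y) last straight))

    -- The terms of the winding number that involve only the two edges adjacent to the extreme point.
    seam : (u₀ t₀ u₁ t₁ uℓ-1 tℓ-1 : ℤ) → ℤ
    seam u₀ t₀ u₁ t₁ uℓ-1 tℓ-1 =
      ((neg (uℓ-1 - u₀) * (pos (tℓ-1 - t₁) - pos (tℓ-1 - t₀))
        + neg (uℓ-1 - u₁) * (pos (t₀ - t₁) - pos (tℓ-1 - t₁)))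
       + (pos (t₀ - tℓ-1) - pos (t₀ - t₁)))
      + (neg (u₀ - uℓ-1) * (pos (t₁ - tℓ-1) - pos (t₀ - tℓ-1))
        + neg (u₁ - uℓ-1) * (pos (t₁ - t₀) - pos (t₁ - tℓ-1)))

    ∑τ≡seam : ∑ τ ℓ ≡ seam (u′ 0) (t′ 0) (u′ 1) (t′ 1) (u′ ℓ-1) (t′ ℓ-1)
    ∑τ≡seam = begin
      ∑ τ ℓ  ≡⟨ cong (_+ τ ℓ-1) (winding-from-base simple′) ⟩
      ((η 0 ℓ-1 + α 1 ℓ-1) + (pos (t′ ℓ - t′ ℓ-1) - pos (t′ ℓ - t′ 1))) + τ ℓ-1
        -- The last turn involves the points `ℓ` and `suc ℓ`, which periodicity identifies with 0
        -- and 1.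
        ≡⟨ cong₂ (λ (x , x′) (y , y′) →
             ((neg (u′ ℓ-1 - u′ 0) * (pos (t′ ℓ-1 - t′ 1) - pos (t′ ℓ-1 - t′ 0))
               + neg (u′ ℓ-1 - u′ 1) * (pos (y - t′ 1) - pos (t′ ℓ-1 - t′ 1)))
              + (pos (y - t′ ℓ-1) - pos (y - t′ 1)))
             + (neg (x - u′ ℓ-1) * (pos (y′ - t′ ℓ-1) - pos (y - t′ ℓ-1))
               + neg (x′ - u′ ℓ-1) * (pos (y′ - y) - pos (y′ - t′ ℓ-1))))
           (cong₂ _,_ (rotated-cycle u u-cycle 0) (rotated-cycle u u-cycle 1))
           (cong₂ _,_ (rotated-cycle t t-cycle 0) (rotated-cycle t t-cycle 1)) ⟩
      seam (u′ 0) (t′ 0) (u′ 1) (t′ 1) (u′ ℓ-1) (t′ ℓ-1) ∎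
      where open ≡-Reasoning

    l₁ : ∀ c p′ → (c - p′) - c ≡ - p′
    l₁ = solve-∀
    l₂ : ∀ c p p′ → (c - p′) - (c + p) ≡ - p′ - p
    l₂ = solve-∀
    l₃ : ∀ c q → c - (c + q) ≡ - q
    l₃ = solve-∀
    l₄ : ∀ c q′ → c - (c - q′) ≡ q′
    l₄ = solve-∀
    l₅ : ∀ c q q′ → (c + q) - (c - q′) ≡ q + q′
    l₅ = solve-∀

    seam-translate : ∀ u₀ t₀ p q p′ q′ → seam u₀ t₀ (u₀ + p) (t₀ + q) (u₀ - p′) (t₀ - q′)
      ≡ ((neg (- p′) * (pos (- q′ - q) - pos (- q′)) + neg (- p′ - p) * (pos (- q) - pos (- q′ - q)))
         + (pos q′ - pos (- q)))
        + (neg p′ * (pos (q + q′) - pos q′) + neg (p + p′) * (pos q - pos (q + q′)))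
    seam-translate u₀ t₀ p q p′ q′
      rewrite l₁ u₀ p′ | l₁ t₀ q′ | l₂ u₀ p p′ | l₂ t₀ q q′ | l₃ t₀ q | l₄ t₀ q′ | l₄ u₀ p′
            | l₅ t₀ q q′ | l₅ u₀ p p′ | left-minus t₀ q = refl

  -- The sign is the orientation: a simple closed curve that passes its leftmost point upwards runs
  -- clockwise, the sense in which crossings of the ray count positively.
  contractible-winding : ∑ (Winding.τ u t step) ℓ ≡ ⟦ Y o ⟧
  contractible-winding = begin
    ∑ (Winding.τ u t step) ℓ  ≡⟨ ∑-shift (Winding.τ u t step) ℓ τ-period o ⟨
    ∑ τ ℓ                     ≡⟨ ∑τ≡seam ⟩
    seam (u′ 0) (t′ 0) (u′ 1) (t′ 1) (u′ ℓ-1) (t′ ℓ-1)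
      ≡⟨ cong₂ (λ (x , x′) (y , y′) → seam (u′ 0) (t′ 0) x y x′ y′) (cong₂ _,_ u₁ uℓ-1) (cong₂ _,_ t₁ tℓ-1) ⟩
    seam (u′ 0) (t′ 0) (u′ 0 + δu Sign.+ (Y o)) (t′ 0 + δt Sign.+ (Y o))
                       (u′ 0 - δu Sign.- (Y o)) (t′ 0 - δt Sign.- (Y o))
      ≡⟨ seam-translate (u′ 0) (t′ 0) (δu Sign.+ (Y o)) (δt Sign.+ (Y o)) (δu Sign.- (Y o)) (δt Sign.- (Y o)) ⟩
    _ ≡⟨ evaluate (Y o) ⟩
    ⟦ Y o ⟧ ∎
    where
    open ≡-Reasoning
    evaluate : ∀ y → let p = δu Sign.+ y; q = δt Sign.+ y; p′ = δu Sign.- y; q′ = δt Sign.- y in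
      ((neg (- p′) * (pos (- q′ - q) - pos (- q′)) + neg (- p′ - p) * (pos (- q) - pos (- q′ - q)))
         + (pos q′ - pos (- q)))
        + (neg p′ * (pos (q + q′) - pos q′) + neg (p + p′) * (pos q - pos (q + q′)))
      ≡ ⟦ y ⟧
    evaluate Sign.+ = refl
    evaluate Sign.- = refl

-- Periodic heights

residue-unique : ∀ {n r r′} → r ℕ.< n → r′ ℕ.< n → + n ∣ + r - + r′ → r ≡ r′
residue-unique {n} {r} {r′} r<n r′<n n∣ = ℤ.+-injective (ℤ.i-j≡0⇒i≡j (+ r) (+ r′)
  (ℤ.∣i∣≡0⇒i≡0 (small ∣ + r - + r′ ∣ (ℕ.≤-<-trans bound (ℕ.⊔-lub r<n r′<n)) (∣⇒∣ᵤ n∣))))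
  where
  small : ∀ m → m ℕ.< n → n ℕ.∣ m → m ≡ 0
  small zero    _   _   = refl
  small (suc m) m<n n∣m = ⊥-elim (ℕ.>⇒∤ m<n n∣m)
  bound : ∣ + r - + r′ ∣ ℕ.≤ r ℕ.⊔ r′
  bound = subst (λ z → ∣ z ∣ ℕ.≤ r ℕ.⊔ r′) (sym (ℤ.m-n≡m⊖n r r′)) (ℤ.∣m⊝n∣≤m⊔n r r′)

Fin-residue-unique : ∀ {n} (i j : Fin n) → + n ∣ + toℕ i - + toℕ j → i ≡ j
Fin-residue-unique i j n∣ = Fin.toℕ-injective (residue-unique (Fin.toℕ<n i) (Fin.toℕ<n j) n∣)

/ℕ-unique : ∀ n .{{_ : NonZero n}} r q → r ℕ.< n → (+ r + q * + n) /ℕ n ≡ q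
/ℕ-unique n r q r<n = sym (ℤ.*-cancelʳ-≡ q q′ (+ n) (+-cancelˡ (+ r) _ _
  (trans (a≡a%ℕn+[a/ℕn]*n z n) (cong (λ m → + m + q′ * + n) r′≡r))))
  where
  z = + r + q * + n
  q′ = z /ℕ n
  lemma : ∀ r r′ q q′ n → r + q * n ≡ r′ + q′ * n → r′ - r ≡ (q - q′) * n
  lemma r r′ q q′ n eq = begin
    r′ - r                          ≡⟨ l₁ r r′ q′ n ⟩
    (r′ + q′ * n) - r - q′ * n      ≡⟨ cong (λ w → w - r - q′ * n) eq ⟨
    (r + q * n) - r - q′ * n        ≡⟨ l₂ r q q′ n ⟩
    (q - q′) * n                    ∎
    where
    open ≡-Reasoning
    l₁ : ∀ r r′ q′ n → r′ - r ≡ (r′ + q′ * n) - r - q′ * n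
    l₁ = solve-∀
    l₂ : ∀ r q q′ n → (r + q * n) - r - q′ * n ≡ (q - q′) * n
    l₂ = solve-∀
  r′≡r : z %ℕ n ≡ r
  r′≡r = residue-unique (n%ℕd<d z n) r<n
    (divides (q - q′) (lemma (+ r) (+ (z %ℕ n)) q q′ (+ n) (a≡a%ℕn+[a/ℕn]*n z n)))

/ℕ-shift : ∀ n .{{_ : NonZero n}} z q → (z + q * + n) /ℕ n ≡ z /ℕ n + q
/ℕ-shift n z q = trans
  (cong (_/ℕ n) (trans (cong (λ w → w + q * + n) (a≡a%ℕn+[a/ℕn]*n z n)) (lemma (+ (z %ℕ n)) (z /ℕ n) q (+ n))))
  (/ℕ-unique n (z %ℕ n) (z /ℕ n + q) (n%ℕd<d z n))
  where
  lemma : ∀ r q′ q n → (r + q′ * n) + q * n ≡ r + (q′ + q) * n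
  lemma = solve-∀

shift-invariant : (D : ℤ → ℤ) → (∀ z → D (z + 1ℤ) ≡ D z) → ∀ z → D z ≡ D 0ℤ
shift-invariant D inv (+ zero)       = refl
shift-invariant D inv (+ suc n)      =
  trans (cong D (ℤ.+-comm 1ℤ (+ n))) (trans (inv (+ n)) (shift-invariant D inv (+ n)))
shift-invariant D inv -[1+ zero ]    = sym (inv -1ℤ)
shift-invariant D inv -[1+ suc n ]   = trans (sym (inv -[1+ suc n ])) (shift-invariant D inv -[1+ n ])

partial-sum : (ℤ → ℤ) → ℤ → ℤ
partial-sum g (+ zero)     = 0ℤ
partial-sum g (+ suc n)    = partial-sum g (+ n) + g (+ n)
partial-sum g -[1+ zero ]  = - g -1ℤ
partial-sum g -[1+ suc n ] = partial-sum g -[1+ n ] - g -[1+ suc n ]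

partial-sum-step : ∀ g z → partial-sum g (z + 1ℤ) ≡ partial-sum g z + g z
partial-sum-step g (+ n)        = cong (partial-sum g) (ℤ.+-comm (+ n) 1ℤ)
partial-sum-step g -[1+ zero ]  = sym (ℤ.+-inverseˡ (g -1ℤ))
partial-sum-step g -[1+ suc n ] = lemma (partial-sum g -[1+ n ]) (g -[1+ suc n ])
  where
  lemma : ∀ s c → s ≡ s - c + c
  lemma = solve-∀

partial-sum-period : ∀ g p → (∀ z → g (z + p) ≡ g z) → ∀ z z′ →
  partial-sum g (z + p) - partial-sum g z ≡ partial-sum g (z′ + p) - partial-sum g z′
partial-sum-period g p per z z′ = trans (shift-invariant D inv z) (sym (shift-invariant D inv z′))
  where
  D : ℤ → ℤ
  D z = partial-sum g (z + p) - partial-sum g z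
  swap : ∀ z p → (z + 1ℤ) + p ≡ (z + p) + 1ℤ
  swap = solve-∀
  cancel : ∀ s s′ c → (s + c) - (s′ + c) ≡ s - s′
  cancel = solve-∀
  inv : ∀ z → D (z + 1ℤ) ≡ D z
  inv z = trans
    (cong₂ _-_ (trans (cong (partial-sum g) (swap z p))
                 (trans (partial-sum-step g (z + p)) (cong (λ c → partial-sum g (z + p) + c) (per z))))
               (partial-sum-step g z))
    (cancel (partial-sum g (z + p)) (partial-sum g z) (g z))

k-∷ : ∀ {n} s (x : Vec Sign n) → k (s ∷ x) ≡ ⟦ s ⟧ + k x
k-∷ Sign.+ x = ℤ.+-assoc 1ℤ (+ count (Sign._≟ Sign.+) x) (- + count (Sign._≟ Sign.-) x)
k-∷ Sign.- x = lemma (+ count (Sign._≟ Sign.+) x) (+ count (Sign._≟ Sign.-) x)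
  where
  lemma : ∀ p q → p - (1ℤ + q) ≡ -1ℤ + (p - q)
  lemma = solve-∀

∑-lookup : ∀ {n} (x : Vec Sign n) (f : ℕ → ℤ) → (∀ j → f (toℕ j) ≡ ⟦ lookup x j ⟧) → ∑ f n ≡ k x
∑-lookup []            f _  = refl
∑-lookup {suc n} (s ∷ x) f eq = trans (sym (∑-head f n))
  (trans (cong₂ _+_ (eq zero) (∑-lookup x (f ∘ suc) (eq ∘ suc))) (sym (k-∷ s x)))

residue : ∀ {n} .{{_ : NonZero n}} → ℤ → Fin n
residue {n} z = Fin.fromℕ< (n%ℕd<d z n)

residue-∣ : ∀ {n} .{{_ : NonZero n}} z → + n ∣ z - + toℕ (residue {n} z)
residue-∣ {n} z = divides (z /ℕ n) (trans
  (cong₂ (λ w r → w - + r) (a≡a%ℕn+[a/ℕn]*n z n) (Fin.toℕ-fromℕ< (n%ℕd<d z n)))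
  (left-minus (+ (z %ℕ n)) (z /ℕ n * + n)))

residue-≡ : ∀ {n} .{{_ : NonZero n}} z (j : Fin n) → + n ∣ z - + toℕ j → residue z ≡ j
residue-≡ {n} z j n∣ = Fin-residue-unique (residue z) j
  (subst (+ n ∣_) (lemma z (+ toℕ (residue {n} z)) (+ toℕ j)) (∣m∣n⇒∣m-n n∣ (residue-∣ z)))
  where
  lemma : ∀ z r j → (z - j) - (z - r) ≡ r - j
  lemma = solve-∀

residue-+ : ∀ {n} .{{_ : NonZero n}} z → residue {n} (z + + n) ≡ residue z
residue-+ {n} z = residue-≡ (z + + n) (residue z) (subst (+ n ∣_) (lemma z (+ n) (+ toℕ (residue {n} z)))
  (∣m∣n⇒∣m+n (residue-∣ z) (divides 1ℤ (sym (ℤ.*-identityˡ (+ n))))))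
  where
  lemma : ∀ z n r → (z - r) + n ≡ (z + n) - r
  lemma = solve-∀

residue-toℕ : ∀ {n} .{{_ : NonZero n}} (j : Fin n) → residue (+ toℕ j) ≡ j
residue-toℕ j = residue-≡ (+ toℕ j) j (divides 0ℤ (ℤ.+-inverseʳ (+ toℕ j)))

module Height {N : ℕ} .{{_ : NonZero N}} (x : Vec Sign N) where

  periodic : ℤ → Sign
  periodic z = lookup x (residue z)

  -- Both half-steps adjacent to the doubled coordinate 2j belong to row j.
  increment : ℤ → ℤ
  increment z = ⟦ periodic ((z + 1ℤ) /ℕ 2) ⟧

  increment-even : ∀ j → increment (j + j) ≡ ⟦ periodic j ⟧
  increment-even j = cong (⟦_⟧ ∘ periodic) (trans (cong (_/ℕ 2) (lemma j)) (/ℕ-unique 2 1 j (ℕ.s≤s (ℕ.s≤s ℕ.z≤n))))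
    where
    lemma : ∀ j → j + j + 1ℤ ≡ 1ℤ + j * + 2
    lemma = solve-∀

  increment-odd : ∀ j → increment (j + j - 1ℤ) ≡ ⟦ periodic j ⟧
  increment-odd j = cong (⟦_⟧ ∘ periodic) (trans (cong (_/ℕ 2) (lemma j)) (/ℕ-unique 2 0 j (ℕ.s≤s ℕ.z≤n)))
    where
    lemma : ∀ j → j + j - 1ℤ + 1ℤ ≡ 0ℤ + j * + 2
    lemma = solve-∀

  increment-period : ∀ z → increment (z + + 2 * + N) ≡ increment z
  increment-period z = cong ⟦_⟧ (trans (cong periodic (trans (cong (_/ℕ 2) (lemma z (+ N)))
    (/ℕ-shift 2 (z + 1ℤ) (+ N)))) (cong (lookup x) (residue-+ ((z + 1ℤ) /ℕ 2))))
    where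
    lemma : ∀ z n → z + + 2 * n + 1ℤ ≡ (z + 1ℤ) + n * + 2
    lemma = solve-∀

  height : ℤ → ℤ
  height = partial-sum increment

  height-up : ∀ j → height (j + j + 1ℤ) ≡ height (j + j) + ⟦ periodic j ⟧
  height-up j = trans (partial-sum-step increment (j + j)) (cong (λ c → height (j + j) + c) (increment-even j))

  height-down : ∀ j → height (j + j) ≡ height (j + j - 1ℤ) + ⟦ periodic j ⟧
  height-down j = trans (cong height (lemma (j + j)))
    (trans (partial-sum-step increment (j + j - 1ℤ)) (cong (λ c → height (j + j - 1ℤ) + c) (increment-odd j)))
    where
    lemma : ∀ z → z ≡ z - 1ℤ + 1ℤ
    lemma = solve-∀

  -- In doubled coordinates -1 is the lower boundary of row 0. Starting there keeps the two
  -- half-steps of every row together, so each sign is counted exactly twice.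
  height-from-−1 : ∀ n → height (+ n + + n - 1ℤ) ≡ height -1ℤ + + 2 * ∑ (λ j → ⟦ periodic (+ j) ⟧) n
  height-from-−1 zero    = sym (ℤ.+-identityʳ _)
  height-from-−1 (suc n) = begin
    height (+ suc n + + suc n - 1ℤ)   ≡⟨ cong height (lemma (+ n)) ⟩
    height (+ n + + n + 1ℤ)           ≡⟨ height-up (+ n) ⟩
    height (+ n + + n) + c            ≡⟨ cong (_+ c) (height-down (+ n)) ⟩
    height (+ n + + n - 1ℤ) + c + c   ≡⟨ cong (λ h → h + c + c) (height-from-−1 n) ⟩
    height -1ℤ + + 2 * S + c + c      ≡⟨ lemma′ (height -1ℤ) S c ⟩
    height -1ℤ + + 2 * (S + c)        ∎
    where
    open ≡-Reasoning
    c = ⟦ periodic (+ n) ⟧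
    S = ∑ (λ j → ⟦ periodic (+ j) ⟧) n
    lemma : ∀ n → (1ℤ + n) + (1ℤ + n) - 1ℤ ≡ n + n + 1ℤ
    lemma = solve-∀
    lemma′ : ∀ h s c → h + + 2 * s + c + c ≡ h + + 2 * (s + c)
    lemma′ = solve-∀

  height-period : ∀ z → height (z + + 2 * + N) ≡ height z + + 2 * k x
  height-period z = begin
    height (z + P)                                  ≡⟨ l₁ (height (z + P)) (height z) ⟩
    height z + (height (z + P) - height z)
      ≡⟨ cong (λ c → height z + c) (partial-sum-period increment P increment-period z -1ℤ) ⟩
    height z + (height (-1ℤ + P) - height -1ℤ)
      ≡⟨ cong (λ w → height z + (w - height -1ℤ)) (trans (cong height (l₂ (+ N))) (height-from-−1 N)) ⟩
    height z + (height -1ℤ + + 2 * ∑ (λ j → ⟦ periodic (+ j) ⟧) N - height -1ℤ)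
      ≡⟨ cong (λ w → height z + (height -1ℤ + + 2 * w - height -1ℤ)) (∑-lookup x _ at-toℕ) ⟩
    height z + (height -1ℤ + + 2 * k x - height -1ℤ) ≡⟨ l₃ (height z) (height -1ℤ) (k x) ⟩
    height z + + 2 * k x                            ∎
    where
    open ≡-Reasoning
    P = + 2 * + N
    at-toℕ : ∀ j → ⟦ periodic (+ toℕ j) ⟧ ≡ ⟦ lookup x j ⟧
    at-toℕ j = cong ⟦_⟧ (cong (lookup x) (residue-toℕ j))
    l₁ : ∀ a b → a ≡ b + (a - b)
    l₁ = solve-∀
    l₂ : ∀ n → -1ℤ + + 2 * n ≡ n + n - 1ℤ
    l₂ = solve-∀
    l₃ : ∀ a b c → a + (b + + 2 * c - b) ≡ a + + 2 * c
    l₃ = solve-∀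

  height-shift : ∀ q z → height (z + q * (+ 2 * + N)) ≡ height z + q * (+ 2 * k x)
  height-shift q z =
    (trans (l₁ (height (z + q * (+ 2 * + N))) (height z + q * (+ 2 * k x)))
      (trans (cong (λ w → w + (height z + q * (+ 2 * k x))) (trans (shift-invariant D inv q) D0≡0)) (ℤ.+-identityˡ _)))
    where
    l₁ : ∀ a b → a ≡ (a - b) + b
    l₁ = solve-∀
    D : ℤ → ℤ
    D q = height (z + q * (+ 2 * + N)) - (height z + q * (+ 2 * k x))
    D0≡0 : D 0ℤ ≡ 0ℤ
    D0≡0 = trans (cong (λ w → height w - (height z + 0ℤ * (+ 2 * k x))) (ℤ.+-identityʳ z)) (l₂ (height z) (k x))
      where
      l₂ : ∀ h k → h - (h + 0ℤ * (+ 2 * k)) ≡ 0ℤ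
      l₂ = solve-∀
    inv : ∀ q → D (q + 1ℤ) ≡ D q
    inv q = trans (cong (λ w → w - (height z + (q + 1ℤ) * (+ 2 * k x)))
                    (trans (cong height (l₃ z q (+ 2 * + N))) (height-period (z + q * (+ 2 * + N)))))
                  (l₄ (height (z + q * (+ 2 * + N))) (height z) q (+ 2 * k x))
      where
      l₃ : ∀ z q p → z + (q + 1ℤ) * p ≡ (z + q * p) + p
      l₃ = solve-∀
      l₄ : ∀ w h q c → (w + c) - (h + (q + 1ℤ) * c) ≡ w - (h + q * c)
      l₄ = solve-∀

∑-sum : ∀ {n} (f : ℕ → ℤ) (g : Fin n → ℤ) → (∀ j → f (toℕ j) ≡ g j) → ∑ f n ≡ sum g
∑-sum {zero}  f g eq = refl
∑-sum {suc n} f g eq = trans (sym (∑-head f n)) (cong₂ _+_ (eq zero) (∑-sum (f ∘ suc) (g ∘ suc) (eq ∘ suc)))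

residue-suc : ∀ {n} .{{_ : NonZero n}} z → residue {n} (1ℤ + z) ≡ next (residue z)
residue-suc {n} z = residue-≡ (1ℤ + z) (next (residue z)) (subst (+ n ∣_)
  (lemma z (+ toℕ (residue {n} z)) (+ toℕ (next (residue {n} z))))
  (∣m∣n⇒∣m+n (residue-∣ {n} z) (mod-step (residue {n} z))))
  where
  lemma : ∀ z r r′ → (z - r) + (1ℤ - (r′ - r)) ≡ (1ℤ + z) - r′
  lemma = solve-∀

next-injective : ∀ {n} (i j : Fin n) → next i ≡ next j → i ≡ j
next-injective {n} i j eq = Fin-residue-unique i j (subst (+ n ∣_)
  (trans (cong (λ r → (1ℤ - (+ toℕ (next i) - + toℕ i)) - (1ℤ - (+ toℕ r - + toℕ j))) (sym eq))
    (lemma (+ toℕ i) (+ toℕ j) (+ toℕ (next i))))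
  (∣m∣n⇒∣m-n (mod-step i) (mod-step j)))
  where
  lemma : ∀ i j r → (1ℤ - (r - i)) - (1ℤ - (r - j)) ≡ i - j
  lemma = solve-∀

-- The walk of a loop

other : Axis → Axis
other horizontal = vertical
other vertical   = horizontal

≢⇒other : ∀ {A B} → A ≢ B → A ≡ other B
≢⇒other {horizontal} {horizontal} A≢B = contradiction refl A≢B
≢⇒other {horizontal} {vertical}   A≢B = refl
≢⇒other {vertical}   {horizontal} A≢B = refl
≢⇒other {vertical}   {vertical}   A≢B = contradiction refl A≢B

displacement-along : ∀ A s → displacement A (A , s) ≡ ⟦ s ⟧
displacement-along horizontal Sign.+ = refl
displacement-along horizontal Sign.- = refl
displacement-along vertical   Sign.+ = refl
displacement-along vertical   Sign.- = refl

displacement-across : ∀ A s → displacement A (other A , s) ≡ 0ℤ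
displacement-across horizontal s = refl
displacement-across vertical   s = refl

coordinate-unique : ∀ {M N} A (v w : Vertex M N) →
  + circumference M N A ∣ coordinate A v - coordinate A w → coordinate A v ≡ coordinate A w
coordinate-unique horizontal (i , _) (i′ , _) M∣ = cong (λ i → + toℕ i) (Fin-residue-unique i i′ M∣)
coordinate-unique vertical   (_ , j) (_ , j′) N∣ = cong (λ j → + toℕ j) (Fin-residue-unique j j′ N∣)

vertex-≡ : ∀ {M N} A (v w : Vertex M N) →
  coordinate A v ≡ coordinate A w → coordinate (other A) v ≡ coordinate (other A) w → v ≡ w
vertex-≡ horizontal v w p q =
  cong₂ _,_ (Fin.toℕ-injective (ℤ.+-injective p)) (Fin.toℕ-injective (ℤ.+-injective q))
vertex-≡ vertical v w p q =
  cong₂ _,_ (Fin.toℕ-injective (ℤ.+-injective q)) (Fin.toℕ-injective (ℤ.+-injective p))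

module Orientation {M N : ℕ} (x : Vec Sign N) (y : Vec Sign M) where

  line-sign : Axis → Vertex M N → Sign
  line-sign horizontal (_ , j) = lookup x j
  line-sign vertical   (i , _) = lookup y i

  line-sign-≡ : ∀ A v w → coordinate (other A) v ≡ coordinate (other A) w → line-sign A v ≡ line-sign A w
  line-sign-≡ horizontal v w p = cong (lookup x) (Fin.toℕ-injective (ℤ.+-injective p))
  line-sign-≡ vertical   v w p = cong (lookup y) (Fin.toℕ-injective (ℤ.+-injective p))

  sign-source : (e : Edge M N) → sign x y e ≡ line-sign (axis e) (source x y e)
  sign-source (horizontal , (i , j)) with lookup x j in eq
  ... | Sign.+ = sym eq
  ... | Sign.- = sym eq
  sign-source (vertical , (i , j)) with lookup y i in eq
  ... | Sign.+ = sym eq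
  ... | Sign.- = sym eq

  sign-target : (e : Edge M N) → sign x y e ≡ line-sign (axis e) (target x y e)
  sign-target (horizontal , (i , j)) with lookup x j in eq
  ... | Sign.+ = sym eq
  ... | Sign.- = sym eq
  sign-target (vertical , (i , j)) with lookup y i in eq
  ... | Sign.+ = sym eq
  ... | Sign.- = sym eq

  far-injective : (e e′ : Edge M N) → axis e ≡ axis e′ → far x y e ≡ far x y e′ → e ≡ e′
  far-injective (horizontal , (i , j)) (horizontal , (i′ , j′)) _ eq =
    cong₂ (λ i j → horizontal , (i , j)) (next-injective i i′ (cong proj₁ eq)) (cong proj₂ eq)
  far-injective (vertical , (i , j)) (vertical , (i′ , j′)) _ eq =
    cong₂ (λ i j → vertical , (i , j)) (cong proj₁ eq) (next-injective j j′ (cong proj₂ eq))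

  source-injective : (e e′ : Edge M N) → axis e ≡ axis e′ → sign x y e ≡ sign x y e′ →
    source x y e ≡ source x y e′ → e ≡ e′
  source-injective e e′ A≡A′ s≡s′ eq with sign x y e | sign x y e′
  source-injective (_ , _) (_ , _) refl refl eq | Sign.+ | Sign.+ = cong (_ ,_) eq
  source-injective e e′ A≡A′ refl eq | Sign.- | Sign.- = far-injective e e′ A≡A′ eq

module _ {n : ℕ} .{{_ : NonZero n}} (z : Vec Sign n) where
  open Height z

  height-+ : ∀ J s → height (J + J + ⟦ s ⟧) ≡ height (J + J) + ⟦ periodic J ⟧ * ⟦ s ⟧
  height-+ J Sign.+ = trans (height-up J) (cong (λ w → height (J + J) + w) (sym (ℤ.*-identityʳ ⟦ periodic J ⟧)))
  height-+ J Sign.- = trans (lemma (height (J + J - 1ℤ)) ⟦ periodic J ⟧)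
    (cong (λ w → w + ⟦ periodic J ⟧ * -1ℤ) (sym (height-down J)))
    where
    lemma : ∀ h c → h ≡ h + c + c * -1ℤ
    lemma = solve-∀

  height-− : ∀ J s → height (J + J) ≡ height (J + J - ⟦ s ⟧) + ⟦ periodic J ⟧ * ⟦ s ⟧
  height-− J Sign.+ = trans (height-down J) (cong (λ w → height (J + J - 1ℤ) + w) (sym (ℤ.*-identityʳ ⟦ periodic J ⟧)))
  height-− J Sign.- = trans (lemma (height (J + J)) ⟦ periodic J ⟧)
    (cong (λ w → w + ⟦ periodic J ⟧ * -1ℤ) (sym (height-up J)))
    where
    lemma : ∀ h c → h ≡ h + c + c * -1ℤ
    lemma = solve-∀

  -- At a vertex with coordinate `p₁` the doubled midpoint moves from 2`p₁` to 2`p₁` + s or from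
  -- 2`p₁` - s to 2`p₁`, according to which edge runs along the axis. In both cases the half-step
  -- belongs to line `p₁`.
  height-turn : ∀ {p₀ p₁ p₂ δ δ′} s → p₁ ≡ p₀ + δ → p₂ ≡ p₁ + δ′ →
    (δ ≡ 0ℤ × δ′ ≡ ⟦ s ⟧) ⊎ (δ ≡ ⟦ s ⟧ × δ′ ≡ 0ℤ) →
    height (p₁ + p₂) ≡ height (p₀ + p₁) + ⟦ periodic p₁ ⟧ * ⟦ s ⟧
  height-turn {p₀} s refl refl (inj₁ (refl , refl)) rewrite ℤ.+-identityʳ p₀ =
    trans (cong height (sym (ℤ.+-assoc p₀ p₀ ⟦ s ⟧))) (height-+ p₀ s)
  height-turn {p₀} s refl refl (inj₂ (refl , refl)) =
    trans (cong height (lemma₁ (p₀ + ⟦ s ⟧)))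
      (trans (height-− (p₀ + ⟦ s ⟧) s)
        (cong (λ w → height w + ⟦ periodic (p₀ + ⟦ s ⟧) ⟧ * ⟦ s ⟧) (lemma₂ p₀ ⟦ s ⟧)))
    where
    lemma₁ : ∀ p → p + (p + 0ℤ) ≡ p + p
    lemma₁ = solve-∀
    lemma₂ : ∀ p s → (p + s) + (p + s) - s ≡ p + (p + s)
    lemma₂ = solve-∀

2∤⟦_⟧ : ∀ s → ¬ + 2 ∣ ⟦ s ⟧
2∤⟦ Sign.+ ⟧ 2∣ with ∣⇒∣ᵤ 2∣
... | ℕ.divides zero    ()
... | ℕ.divides (suc q) ()
2∤⟦ Sign.- ⟧ 2∣ with ∣⇒∣ᵤ 2∣
... | ℕ.divides zero    ()
... | ℕ.divides (suc q) ()

module LoopWalk {M N : ℕ} .{{_ : NonZero M}} .{{_ : NonZero N}} {x : Vec Sign N} {y : Vec Sign M}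
  (L : Loop x y) where

  open Orientation x y
  open Loop L using (edges; nonempty; connected; trail; alternating)

  private
    ℓ : ℕ
    ℓ = length L

    instance
      ℓ≢0 : NonZero ℓ
      ℓ≢0 = nonempty

    circ : Axis → ℤ
    circ A = + circumference M N A

  edge : ℕ → Edge M N
  edge m = lookup edges (residue (+ m))

  src tgt : ℕ → Vertex M N
  src m = source x y (edge m)
  tgt m = target x y (edge m)

  connect : ∀ m → tgt m ≡ src (suc m)
  connect m = trans (connected (residue (+ m)))
    (cong (source x y ∘ lookup edges) (sym (residue-suc (+ m))))

  alternate : ∀ m → axis (edge m) ≢ axis (edge (suc m))
  alternate m eq = alternating (residue (+ m))
    (trans eq (cong (axis ∘ lookup edges) (residue-suc (+ m))))

  edge-period : ∀ m → edge (m ℕ.+ ℓ) ≡ edge m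
  edge-period m = cong (lookup edges) (residue-+ (+ m))

  -- The lift to ℤ²: `p` accumulates displacements from a representative of the first source, and
  -- the sum of both ends of an edge is its doubled midpoint.
  δ p mid : Axis → ℕ → ℤ
  δ A m = displacement A (heading x y (edge m))
  p A zero    = coordinate A (src 0)
  p A (suc m) = p A m + δ A m
  mid A m = p A m + p A (suc m)

  p-∣ : ∀ A m → circ A ∣ p A m - coordinate A (src m)
  p-∣ A zero    = divides 0ℤ (ℤ.+-inverseʳ (coordinate A (src 0)))
  p-∣ A (suc m) = subst (circ A ∣_) (cong (λ v → p A (suc m) - coordinate A v) (connect m))
    (subst (circ A ∣_) (lemma (p A m) (coordinate A (src m)) (δ A m) (coordinate A (tgt m)))
      (∣m∣n⇒∣m+n (p-∣ A m) (∣-edge x y A (edge m))))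
    where
    lemma : ∀ p s d t → (p - s) + (d - (t - s)) ≡ (p + d) - t
    lemma = solve-∀

  δ-along : ∀ {A} m → axis (edge m) ≡ A → δ A m ≡ ⟦ sign x y (edge m) ⟧
  δ-along m refl = displacement-along (axis (edge m)) _

  δ-across : ∀ {A} m → axis (edge m) ≡ other A → δ A m ≡ 0ℤ
  δ-across {A} m eq = trans (cong (λ B → displacement A (B , sign x y (edge m))) eq) (displacement-across A _)

  mid-δ : ∀ A m → mid A m ≡ + 2 * p A m + δ A m
  mid-δ A m = lemma (p A m) (δ A m)
    where
    lemma : ∀ p d → p + (p + d) ≡ + 2 * p + d
    lemma = solve-∀

  heading-sign : Axis → ℕ → Sign
  heading-sign A m = line-sign A (tgt m)

  δ-turn : ∀ A m → (δ A m ≡ 0ℤ × δ A (suc m) ≡ ⟦ heading-sign A m ⟧)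
                 ⊎ (δ A m ≡ ⟦ heading-sign A m ⟧ × δ A (suc m) ≡ 0ℤ)
  δ-turn A m with axis (edge m) ≟ᴬ A
  ... | yes eq = inj₂
    ( trans (δ-along m eq) (cong ⟦_⟧ (trans (sign-target (edge m)) (cong (λ B → line-sign B (tgt m)) eq)))
    , δ-across (suc m) (≢⇒other λ eq′ → alternate m (trans eq (sym eq′))))
  ... | no neq with axis (edge (suc m)) ≟ᴬ A
  ...   | yes eq = inj₁
    ( δ-across m (≢⇒other neq)
    , trans (δ-along (suc m) eq) (cong ⟦_⟧ (trans (sign-source (edge (suc m)))
        (cong₂ line-sign eq (sym (connect m))))))
  ...   | no neq′ = contradiction (trans (≢⇒other neq) (sym (≢⇒other neq′))) (alternate m)

  mid-step : ∀ A m → mid A (suc m) ≡ mid A m + ⟦ heading-sign A m ⟧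
  mid-step A m = trans (lemma (p A m) (δ A m) (δ A (suc m))) (cong (λ w → mid A m + w) total)
    where
    lemma : ∀ p d d′ → (p + d) + ((p + d) + d′) ≡ (p + (p + d)) + (d + d′)
    lemma = solve-∀
    total : δ A m + δ A (suc m) ≡ ⟦ heading-sign A m ⟧
    total with δ-turn A m
    ... | inj₁ (q , r) = trans (cong₂ _+_ q r) (ℤ.+-identityˡ _)
    ... | inj₂ (q , r) = trans (cong₂ _+_ q r) (ℤ.+-identityʳ _)

  -- Edge `suc m` runs along a single line, and the turns `m` and `suc m` take place at its two
  -- ends.
  heading-straight : ∀ A m → axis (edge (suc m)) ≡ A → heading-sign A m ≡ heading-sign A (suc m)
  heading-straight A m refl = trans (cong (line-sign A) (connect m))
    (trans (sym (sign-source (edge (suc m)))) (sign-target (edge (suc m))))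

  2∣circ : ∀ {A z} → + 2 * circ A ∣ z → + 2 ∣ z
  2∣circ {A} (divides q eq) = divides (q * circ A) (trans eq (lemma q (circ A)))
    where
    lemma : ∀ q c → q * (+ 2 * c) ≡ q * c * + 2
    lemma = solve-∀

  halve : ∀ {c z} → + 2 * c ∣ + 2 * z → c ∣ z
  halve {c} {z} (divides q eq) = divides q (ℤ.*-cancelˡ-≡ (+ 2) z (q * c) (trans eq (lemma q c)))
    where
    lemma : ∀ q c → q * (+ 2 * c) ≡ + 2 * (q * c)
    lemma = solve-∀

  -- A doubled midpoint is odd along its edge and even across it, so parity reveals the axis. The
  -- transverse coordinate then determines the line, hence its sign, and with the sign the half-edge
  -- can be subtracted to recover the source.
  mid-injective : ∀ i j → (∀ A → + 2 * circ A ∣ mid A i - mid A j) → edge i ≡ edge j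
  mid-injective i j close with axis (edge j) ≟ᴬ axis (edge i)
  ... | no neq = contradiction (subst (+ 2 ∣_) odd (∣m∣n⇒∣m-n (2∣circ {A} (close A)) even)) 2∤⟦ sign x y (edge i) ⟧
    where
    A : Axis
    A = axis (edge i)
    even : + 2 ∣ + 2 * (p A i - p A j)
    even = divides (p A i - p A j) (ℤ.*-comm (+ 2) (p A i - p A j))
    lemma : ∀ p p′ s → (+ 2 * p + s) - (+ 2 * p′ + 0ℤ) - + 2 * (p - p′) ≡ s
    lemma = solve-∀
    odd : mid A i - mid A j - + 2 * (p A i - p A j) ≡ ⟦ sign x y (edge i) ⟧
    odd = trans (cong₂ (λ w w′ → w - w′ - + 2 * (p A i - p A j))
        (trans (mid-δ A i) (cong (λ w → + 2 * p A i + w) (δ-along i refl)))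
        (trans (mid-δ A j) (cong (λ w → + 2 * p A j + w) (δ-across j (≢⇒other neq)))))
      (lemma (p A i) (p A j) _)
  ... | yes eqⱼ = source-injective (edge i) (edge j) (sym eqⱼ) sign≡
      (vertex-≡ A (src i) (src j) along across)
    where
    A : Axis
    A = axis (edge i)
    from-mid : ∀ B → δ B i ≡ δ B j → coordinate B (src i) ≡ coordinate B (src j)
    from-mid B δ≡ = coordinate-unique B (src i) (src j) (subst (circ B ∣_)
      (lemma (p B i) (p B j) (coordinate B (src i)) (coordinate B (src j)))
      (∣m∣n⇒∣m+n (∣m∣n⇒∣m-n p∣ (p-∣ B i)) (p-∣ B j)))
      where
      lemma : ∀ p p′ s s′ → ((p - p′) - (p - s)) + (p′ - s′) ≡ s - s′
      lemma = solve-∀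
      lemma′ : ∀ p p′ d → (+ 2 * p + d) - (+ 2 * p′ + d) ≡ + 2 * (p - p′)
      lemma′ = solve-∀
      p∣ : circ B ∣ p B i - p B j
      p∣ = halve (subst (+ 2 * circ B ∣_)
        (trans (cong₂ _-_ (mid-δ B i) (trans (mid-δ B j) (cong (λ d → + 2 * p B j + d) (sym δ≡))))
          (lemma′ (p B i) (p B j) (δ B i))) (close B))
    axis-other : ∀ m → axis (edge m) ≡ A → axis (edge m) ≡ other (other A)
    axis-other m eq = trans eq (involutive A)
      where
      involutive : ∀ B → B ≡ other (other B)
      involutive horizontal = refl
      involutive vertical   = refl
    across : coordinate (other A) (src i) ≡ coordinate (other A) (src j)
    across = from-mid (other A) (trans (δ-across i (axis-other i refl)) (sym (δ-across j (axis-other j eqⱼ))))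
    sign≡ : sign x y (edge i) ≡ sign x y (edge j)
    sign≡ = trans (sign-source (edge i)) (trans (line-sign-≡ A (src i) (src j) across)
      (sym (trans (sign-source (edge j)) (cong (λ B → line-sign B (src j)) eqⱼ))))
    along : coordinate A (src i) ≡ coordinate A (src j)
    along = from-mid A (trans (δ-along i refl) (trans (cong ⟦_⟧ sign≡) (sym (δ-along j eqⱼ))))

  edge-simple : ∀ i d → suc d ℕ.< ℓ → edge i ≢ edge (suc d ℕ.+ i)
  edge-simple i d d<ℓ eq = contradiction (∣⇒∣ᵤ (subst (+ ℓ ∣_)
      (trans (cong (λ r → (+ (suc d ℕ.+ i) - + toℕ r′) - (+ i - + toℕ r)) (trail {r} {r′} eq))
        (lemma (+ suc d) (+ i) (+ toℕ r′)))
      (∣m∣n⇒∣m-n (residue-∣ (+ (suc d ℕ.+ i))) (residue-∣ (+ i)))))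
    (ℕ.>⇒∤ d<ℓ)
    where
    r r′ : Fin ℓ
    r = residue (+ i)
    r′ = residue (+ (suc d ℕ.+ i))
    lemma : ∀ d i r → (d + i - r) - (i - r) ≡ d
    lemma = solve-∀

  p-total : ∀ A → p A ℓ ≡ p A 0 + Δ L A
  p-total A = trans (∑-telescope (p A) (δ A) (λ _ → refl) ℓ) (cong (λ w → p A 0 + w) (begin
    ∑ (δ A) ℓ  ≡⟨ ∑-sum (δ A) (displacement A ∘ heading x y ∘ lookup edges)
                    (λ j → cong (displacement A ∘ heading x y ∘ lookup edges) (residue-toℕ j)) ⟩
    sum (displacement A ∘ heading x y ∘ lookup edges)  ≡⟨ sum-displacement x y A edges ⟩
    Δ L A      ∎))
    where open ≡-Reasoning

  mid-total : ∀ A → mid A ℓ - mid A 0 ≡ + 2 * Δ L A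
  mid-total A = trans (cong₂ (λ q d → (q + (q + d)) - mid A 0) (p-total A)
      (cong (displacement A ∘ heading x y) (edge-period 0)))
    (lemma (p A 0) (Δ L A) (δ A 0))
    where
    lemma : ∀ p t d → ((p + t) + ((p + t) + d)) - (p + (p + d)) ≡ + 2 * t
    lemma = solve-∀

  indicator : Axis → ℤ
  indicator horizontal = 1ℤ
  indicator vertical   = 0ℤ

  walk : Walk ℓ
  walk = record
    { X = heading-sign horizontal
    ; Y = heading-sign vertical
    ; a = mid horizontal
    ; b = mid vertical
    ; v = indicator ∘ axis ∘ edge
    ; a-step = mid-step horizontal
    ; b-step = mid-step vertical
    ; turn = turn
    ; X-period = λ m → cong (λ e → line-sign horizontal (target x y e)) (edge-period m)
    ; Y-period = λ m → cong (λ e → line-sign vertical (target x y e)) (edge-period m)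
    ; v-period = λ m → cong (indicator ∘ axis) (edge-period m)
    ; simple = λ i d d<ℓ (p , q) → edge-simple i d d<ℓ (mid-injective i _ λ where
        horizontal → divides 0ℤ (ℤ.i≡j⇒i-j≡0 p)
        vertical   → divides 0ℤ (ℤ.i≡j⇒i-j≡0 q))
    }
    where
    turn : ∀ m →
      (indicator (axis (edge m)) ≡ 0ℤ × indicator (axis (edge (suc m))) ≡ 1ℤ
        × heading-sign horizontal m ≡ heading-sign horizontal (suc m))
      ⊎ (indicator (axis (edge m)) ≡ 1ℤ × indicator (axis (edge (suc m))) ≡ 0ℤ
        × heading-sign vertical m ≡ heading-sign vertical (suc m))
    turn m with axis (edge m) in eq | axis (edge (suc m)) in eq′
    ... | horizontal | horizontal = contradiction (trans eq (sym eq′)) (alternate m)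
    ... | horizontal | vertical   = inj₂ (refl , refl , heading-straight vertical m eq′)
    ... | vertical   | horizontal = inj₁ (refl , refl , heading-straight horizontal m eq′)
    ... | vertical   | vertical   = contradiction (trans eq (sym eq′)) (alternate m)

  private
    module Hx = Height x
    module Hy = Height y

  -- The line sign supplied by `height-turn` is that of the row through the turning vertex; the
  -- horizontal edge at that vertex lies in this row, so the sign is X.
  height-row : ∀ m → Hx.height (mid vertical (suc m))
    ≡ Hx.height (mid vertical m) + ⟦ heading-sign horizontal m ⟧ * ⟦ heading-sign vertical m ⟧
  height-row m = trans (height-turn x {p vertical m} (heading-sign vertical m) refl refl (δ-turn vertical m))
    (cong (λ s → Hx.height (mid vertical m) + ⟦ s ⟧ * ⟦ heading-sign vertical m ⟧)
      (trans (cong (lookup x) (residue-≡ (p vertical (suc m)) (proj₂ (src (suc m))) (p-∣ vertical (suc m))))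
        (sym (cong (lookup x ∘ proj₂) (connect m)))))

  -- The increment is the same as in `height-row`. With one sign vector for rows and columns, the
  -- heights at `a` and at `b` therefore keep a constant difference, which drives both the diagonal
  -- and the quadrant argument.
  height-column : ∀ m → Hy.height (mid horizontal (suc m))
    ≡ Hy.height (mid horizontal m) + ⟦ heading-sign horizontal m ⟧ * ⟦ heading-sign vertical m ⟧
  height-column m = trans (height-turn y {p horizontal m} (heading-sign horizontal m) refl refl (δ-turn horizontal m))
    (trans (cong (λ s → Hy.height (mid horizontal m) + ⟦ s ⟧ * ⟦ heading-sign horizontal m ⟧)
      (trans (cong (lookup y) (residue-≡ (p horizontal (suc m)) (proj₁ (src (suc m))) (p-∣ horizontal (suc m))))
        (sym (cong (lookup y ∘ proj₁) (connect m)))))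
      (cong (λ w → Hy.height (mid horizontal m) + w) (ℤ.*-comm ⟦ heading-sign vertical m ⟧ ⟦ heading-sign horizontal m ⟧)))

-- Loops in symmetric patterns

module _ {n : ℕ} .{{_ : NonZero n}} where

  /ℕ-mono-< : ∀ z q → z ℤ.< q * + n → z /ℕ n ℤ.< q
  /ℕ-mono-< z q z<qn = ℤ.*-cancelʳ-<-nonNeg (+ n) (ℤ.≤-<-trans
    ([n/ℕd]*d≤n z n) z<qn)

  /ℕ-cancel-< : ∀ z q → z /ℕ n ℤ.< q → z ℤ.< q * + n
  /ℕ-cancel-< z q z/n<q = ℤ.<-≤-trans (n<s[n/ℕd]*d z n)
    (ℤ.*-monoʳ-≤-nonNeg (+ n) (ℤ.i<j⇒suc[i]≤j z/n<q))

/ℕ-adjacent : ∀ n .{{_ : NonZero n}} z → (z + 1ℤ) /ℕ n ≡ z /ℕ n ⊎ ∃[ q ] z + 1ℤ ≡ q * + n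
/ℕ-adjacent n z with ℕ.m≤n⇒m<n∨m≡n (n%ℕd<d z n)
... | inj₁ r<n = inj₁ (trans (cong (_/ℕ n)
    (trans (cong (_+ 1ℤ) (a≡a%ℕn+[a/ℕn]*n z n)) (lemma (+ (z %ℕ n)) (z /ℕ n) (+ n))))
    (/ℕ-unique n (suc (z %ℕ n)) (z /ℕ n) r<n))
  where
  lemma : ∀ r q n → r + q * n + 1ℤ ≡ (1ℤ + r) + q * n
  lemma = solve-∀
... | inj₂ r≡n = inj₂ (z /ℕ n + 1ℤ , (begin
    z + 1ℤ                              ≡⟨ cong (_+ 1ℤ) (a≡a%ℕn+[a/ℕn]*n z n) ⟩
    + (z %ℕ n) + z /ℕ n * + n + 1ℤ      ≡⟨ lemma (+ (z %ℕ n)) (z /ℕ n * + n) ⟩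
    + suc (z %ℕ n) + z /ℕ n * + n       ≡⟨ cong (λ r → + r + z /ℕ n * + n) r≡n ⟩
    + n + z /ℕ n * + n                  ≡⟨ lemma′ (+ n) (z /ℕ n) ⟩
    (z /ℕ n + 1ℤ) * + n                 ∎))
  where
  open ≡-Reasoning
  lemma : ∀ r c → r + c + 1ℤ ≡ (1ℤ + r) + c
  lemma = solve-∀
  lemma′ : ∀ n q → n + q * n ≡ (q + 1ℤ) * n
  lemma′ = solve-∀

/ℕ-pred : ∀ n .{{_ : NonZero n}} q → (q * + n - 1ℤ) /ℕ n ≡ q - 1ℤ
/ℕ-pred (suc n) q = trans (cong (_/ℕ suc n) (lemma q (+ n))) (/ℕ-unique (suc n) n (q - 1ℤ) (ℕ.n<1+n n))
  where
  lemma : ∀ q n → q * (1ℤ + n) - 1ℤ ≡ n + (q - 1ℤ) * (1ℤ + n)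
  lemma = solve-∀

-- First passages of a climbing function and the quadrants they bound

least : ∀ {P : ℕ → Set} → Decidable P → ∀ n → P n → ∃[ m ] (P m × (∀ i → i ℕ.< m → ¬ P i))
least P? zero    Pn = 0 , Pn , λ _ ()
least {P} P? (suc n) Pn with P? 0
... | yes P0 = 0 , P0 , λ _ ()
... | no ¬P0 with least (P? ∘ suc) n Pn
...   | m , Pm , min = suc m , Pm , min′
  where
  min′ : ∀ i → i ℕ.< suc m → ¬ P i
  min′ zero    _           = ¬P0
  min′ (suc i) (ℕ.s≤s i<m) = min i i<m

-- A second increment within the first `ℓ` steps would carry a second mark fewer than `ℓ` indices
-- after the first.
increments-≤1 : ∀ (f : ℕ → ℤ) e (Mark : ℕ → Set) ℓ →
  (∀ m → f (suc m) ≡ f m ⊎ (f (suc m) ≡ f m + e × Mark m)) →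
  (∀ i d → suc d ℕ.< ℓ → Mark i → ¬ Mark (suc d ℕ.+ i)) →
  f ℓ ≡ f 0 ⊎ f ℓ ≡ f 0 + e
increments-≤1 f e Mark ℓ inc once with go ℓ ℕ.≤-refl
  where
  go : ∀ n → n ℕ.≤ ℓ → f n ≡ f 0 ⊎ (f n ≡ f 0 + e × ∃[ i ] (i ℕ.< n × Mark i))
  go zero    _ = inj₁ refl
  go (suc n) n<ℓ with inc n | go n (ℕ.<⇒≤ n<ℓ)
  ... | inj₁ eq       | inj₁ eq′ = inj₁ (trans eq eq′)
  ... | inj₁ eq       | inj₂ (eq′ , i , i<n , Mi) = inj₂ (trans eq eq′ , i , ℕ.m≤n⇒m≤1+n i<n , Mi)
  ... | inj₂ (eq , Mn) | inj₁ eq′ = inj₂ (trans eq (cong (_+ e) eq′) , n , ℕ.≤-refl , Mn)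
  ... | inj₂ (eq , Mn) | inj₂ (_ , i , i<n , Mi) =
    contradiction (subst Mark (sym n≡) Mn) (once i (n ℕ.∸ suc i) (ℕ.≤-<-trans d<n n<ℓ) Mi)
    where
    n≡ : suc (n ℕ.∸ suc i) ℕ.+ i ≡ n
    n≡ = trans (sym (ℕ.+-suc (n ℕ.∸ suc i) i)) (ℕ.m∸n+n≡m i<n)
    d<n : suc (n ℕ.∸ suc i) ℕ.≤ n
    d<n = ℕ.m+n≤o⇒m≤o _ (ℕ.≤-reflexive n≡)
... | inj₁ eq       = inj₁ eq
... | inj₂ (eq , _) = inj₂ eq

crossing-up : ∀ {z z′ T} → Adjacent z z′ → z ℤ.< T → T ℤ.≤ z′ → z′ ≡ z + 1ℤ × z′ ≡ T
crossing-up {z} (up refl) z<T T≤z′ = refl ,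
  ℤ.≤-antisym (subst (ℤ._≤ _) (ℤ.+-comm 1ℤ z) (ℤ.i<j⇒suc[i]≤j z<T)) T≤z′
crossing-up {z} (down refl) z<T T≤z′ =
  contradiction (ℤ.≤-trans T≤z′ (ℤ.i-j≤i z 1ℤ)) (ℤ.<⇒≱ z<T)

module Climbing (s : ℤ → ℤ) (P : ℕ) .{{_ : NonZero P}} (κ : ℕ)
  (s-shift : ∀ q z → s (z + q * + P) ≡ s z + q * + suc κ) where

  FirstPassage : ℤ → ℤ → Set
  FirstPassage A F = A ℤ.≤ s F × (∀ z → z ℤ.< F → s z ℤ.< A)

  s-bounded : ∃[ B ] (∀ r → r ℕ.< P → s (+ r) ℤ.≤ B)
  s-bounded with argmin (λ r → - s (+ r)) P
  ... | o , min = s (+ o) , λ r r<P → ℤ.neg-cancel-≤ (min r (ℕ.m≤n⇒m≤1+n r<P))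

  -∣z∣≤z : ∀ z → - + ∣ z ∣ ℤ.≤ z
  -∣z∣≤z (+ n)    = ℤ.neg-≤-pos
  -∣z∣≤z -[1+ n ] = ℤ.≤-refl

  z≤∣z∣ : ∀ z → z ℤ.≤ + ∣ z ∣
  z≤∣z∣ (+ n)    = ℤ.≤-refl
  z≤∣z∣ -[1+ n ] = -≤+

  -- Over one period `s` is bounded by some B, and each period further left lowers it by at least 1.
  -- Going back |A - B| + 1 periods therefore brings it below A for good.
  eventually-low : ∀ A → ∃[ n ] (∀ z → z ℤ.< -[1+ n ] * + P → s z ℤ.< A)
  eventually-low A = ∣ A - B ∣ , low
    where
    B = proj₁ s-bounded
    n = ∣ A - B ∣
    low : ∀ z → z ℤ.< -[1+ n ] * + P → s z ℤ.< A
    low z z< = begin-strict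
      s z                                ≡⟨ cong s (a≡a%ℕn+[a/ℕn]*n z P) ⟩
      s (+ (z %ℕ P) + z /ℕ P * + P)      ≡⟨ s-shift (z /ℕ P) (+ (z %ℕ P)) ⟩
      s (+ (z %ℕ P)) + z /ℕ P * + suc κ
        ≤⟨ ℤ.+-mono-≤ (proj₂ s-bounded (z %ℕ P) (n%ℕd<d z P))
             (ℤ.*-monoʳ-≤-nonNeg (+ suc κ) (ℤ.<⇒≤ (/ℕ-mono-< z -[1+ n ] z<))) ⟩
      B + -[1+ n ] * + suc κ
        ≤⟨ ℤ.+-monoʳ-≤ B (subst (-[1+ n ] * + suc κ ℤ.≤_) (ℤ.*-identityʳ -[1+ n ])
             (ℤ.*-monoˡ-≤-nonPos -[1+ n ] (+≤+ (ℕ.s≤s (ℕ.z≤n {κ}))))) ⟩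
      B + -[1+ n ]                       <⟨ ℤ.+-monoʳ-< B (ℤ.<-≤-trans below (-∣z∣≤z (A - B))) ⟩
      B + (A - B)                        ≡⟨ lemma A B ⟩
      A                                  ∎
      where
      open ℤ.≤-Reasoning
      below : -[1+ n ] ℤ.< - + n
      below = ℤ.i≤pred[j]⇒i<j (ℤ.≤-reflexive (ℤ.neg-suc n))
      lemma : ∀ A B → B + (A - B) ≡ A
      lemma = solve-∀

  high : ∀ A → A ℤ.≤ s (+ ∣ A - s 0ℤ ∣ * + P)
  high A = begin
    A                                ≡⟨ lemma A (s 0ℤ) ⟩
    s 0ℤ + (A - s 0ℤ)                ≤⟨ ℤ.+-monoʳ-≤ (s 0ℤ) (z≤∣z∣ (A - s 0ℤ)) ⟩
    s 0ℤ + q                         ≡⟨ cong (λ w → s 0ℤ + w) (ℤ.*-identityʳ q) ⟨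
    s 0ℤ + q * 1ℤ                    ≤⟨ ℤ.+-monoʳ-≤ (s 0ℤ) (ℤ.*-monoˡ-≤-nonNeg q (+≤+ (ℕ.s≤s (ℕ.z≤n {κ})))) ⟩
    s 0ℤ + q * + suc κ               ≡⟨ s-shift q 0ℤ ⟨
    s (0ℤ + q * + P)                 ≡⟨ cong s (ℤ.+-identityˡ (q * + P)) ⟩
    s (q * + P)                      ∎
    where
    open ℤ.≤-Reasoning
    q = + ∣ A - s 0ℤ ∣
    lemma : ∀ A c → A ≡ c + (A - c)
    lemma = solve-∀

  offset-cancel : ∀ m n → -[1+ n ] * + P + + ((m ℕ.+ suc n) ℕ.* P) ≡ + m * + P
  offset-cancel m n = trans (cong (λ v → -[1+ n ] * + P + v) (ℤ.pos-* (m ℕ.+ suc n) P))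
    (lemma (+ suc n) (+ m) (+ P))
    where
    lemma : ∀ n m p → (- n) * p + (m + n) * p ≡ m * p
    lemma = solve-∀

  search : ∀ A z₀ w → (∀ z → z ℤ.< z₀ → s z ℤ.< A) → A ℤ.≤ s (z₀ + + w) → ∃[ F ] FirstPassage A F
  search A z₀ w low high with least (λ i → A ℤ.≤? s (z₀ + + i)) w high
  ... | m , reached , earlier = z₀ + + m , reached , before
    where
    before : ∀ z → z ℤ.< z₀ + + m → s z ℤ.< A
    before z z< with z ℤ.<? z₀
    ... | yes z<z₀ = low z z<z₀
    ... | no z≮z₀ = subst (λ v → s v ℤ.< A) z≡ (ℤ.≰⇒> (earlier i i<m))
      where
      i = ∣ z - z₀ ∣
      i≡ : + i ≡ z - z₀
      i≡ = ℤ.0≤i⇒+∣i∣≡i (ℤ.i≤j⇒0≤j-i (ℤ.≮⇒≥ z≮z₀))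
      lemma : ∀ z c → c + (z - c) ≡ z
      lemma = solve-∀
      z≡ : z₀ + + i ≡ z
      z≡ = trans (cong (λ v → z₀ + v) i≡) (lemma z z₀)
      i<m : i ℕ.< m
      i<m = ℤ.drop‿+<+ (subst₂ ℤ._<_ (sym i≡) (left-minus z₀ (+ m)) (ℤ.+-monoˡ-< (- z₀) z<))

  abstract
    first-passage : ∀ A → ∃[ F ] FirstPassage A F
    first-passage A with eventually-low A
    ... | n , low = search A (-[1+ n ] * + P) ((∣ A - s 0ℤ ∣ ℕ.+ suc n) ℕ.* P) low
      (subst (λ v → A ℤ.≤ s v) (sym (offset-cancel ∣ A - s 0ℤ ∣ n)) (high A))

  -- Along a walk with s b = s a + C, the conditions s a < A and s b < A + C are equivalent, so a < F and
  -- b < G fail together: the walk leaves this quadrant through its corner.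
  module Corner {A C F G : ℤ} (F-first : FirstPassage A F) (G-first : FirstPassage (A + C) G) where

    level : ℤ → ℤ → ℤ
    level T z = (z - T) /ℕ P

    below : ∀ T z r → level T z ℤ.< r → z ℤ.< T + r * + P
    below T z r l = subst₂ ℤ._<_ (lemma z T) (ℤ.+-comm (r * + P) T) (ℤ.+-monoˡ-< T (/ℕ-cancel-< (z - T) r l))
      where
      lemma : ∀ z T → z - T + T ≡ z
      lemma = solve-∀

    above : ∀ T z r → ¬ level T z ℤ.< r → T + r * + P ℤ.≤ z
    above T z r l = ℤ.≮⇒≥ λ z< → l (/ℕ-mono-< (z - T) r
      (subst (z - T ℤ.<_) (left-minus T (r * + P)) (ℤ.+-monoˡ-< (- T) z<)))

    s-before : ∀ {B T} → FirstPassage B T → ∀ r z → z ℤ.< T + r * + P → s z ℤ.< B + r * + suc κ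
    s-before {B} {T} (_ , before) r z z< = subst (ℤ._< B + r * + suc κ)
      (trans (sym (s-shift r (z - r * + P))) (cong s (lemma z (r * + P))))
      (ℤ.+-monoˡ-< (r * + suc κ) (before (z - r * + P)
        (subst (z - r * + P ℤ.<_) (lemma′ T (r * + P)) (ℤ.+-monoˡ-< (- (r * + P)) z<))))
      where
      lemma : ∀ z c → z - c + c ≡ z
      lemma = solve-∀
      lemma′ : ∀ t c → t + c - c ≡ t
      lemma′ = solve-∀

    s-at : ∀ {B T} → FirstPassage B T → ∀ r → B + r * + suc κ ℤ.≤ s (T + r * + P)
    s-at {B} {T} (at , _) r = subst (B + r * + suc κ ℤ.≤_) (sym (s-shift r T)) (ℤ.+-monoˡ-≤ (r * + suc κ) at)

    -- The least r such that (a, b) lies in the quadrant with corner (F + (r + 1) P, G + (r + 1) P).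
    rank : ℤ → ℤ → ℤ
    rank a b = level F a ⊔ level G b

    Exit : (a b a′ b′ : ℤ) → Set
    Exit a b a′ b′ = rank a′ b′ ≡ rank a b + 1ℤ × a′ ≡ a + 1ℤ × b′ ≡ b + 1ℤ × s b ℤ.< s b′
      × (+ P ∣ a′ - F) × (+ P ∣ b′ - G)

    -- The new rank `r` selects the translate of the quadrant that is being left, and one coordinate
    -- attains it. Reaching that side means that `s` has reached the threshold there, hence also at
    -- the other coordinate, which cannot remain before its own first passage. At the previous point
    -- `s` was below the threshold, so it rises.
    exit : ∀ {a b a′ b′} → Adjacent a a′ → Adjacent b b′ → s b ≡ s a + C → s b′ ≡ s a′ + C →
      rank a b ℤ.< rank a′ b′ → Exit a b a′ b′
    exit {a} {b} {a′} {b′} a~a′ b~b′ sb sb′ lt = conclude (corner-reached (ℤ.⊔-sel (level F a′) (level G b′)))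
      where
      r = rank a′ b′
      a< : a ℤ.< F + r * + P
      a< = below F a r (ℤ.≤-<-trans (ℤ.i≤i⊔j (level F a) (level G b)) lt)
      b< : b ℤ.< G + r * + P
      b< = below G b r (ℤ.≤-<-trans (ℤ.i≤j⊔i (level F a) (level G b)) lt)
      swap : ∀ A C e → (A + C) + e ≡ (A + e) + C
      swap = solve-∀
      corner-reached : r ≡ level F a′ ⊎ r ≡ level G b′ →
        (a′ ≡ a + 1ℤ × a′ ≡ F + r * + P) × (b′ ≡ b + 1ℤ × b′ ≡ G + r * + P)
      corner-reached (inj₁ eq) = at-F , crossing-up b~b′ b< (ℤ.≮⇒≥ λ b′< →
          ℤ.<⇒≱ (s-before G-first r b′ b′<)
            (subst₂ ℤ._≤_ (sym (swap A C (r * + suc κ))) (sym (trans sb′ (cong (λ w → s w + C) (proj₂ at-F))))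
              (ℤ.+-monoˡ-≤ C (s-at F-first r))))
        where
        at-F : a′ ≡ a + 1ℤ × a′ ≡ F + r * + P
        at-F = crossing-up a~a′ a< (above F a′ r (ℤ.<-irrefl (sym eq)))
      corner-reached (inj₂ eq) = crossing-up a~a′ a< (ℤ.≮⇒≥ λ a′< →
          ℤ.<⇒≱ (subst₂ ℤ._<_ (sym sb′) (sym (swap A C (r * + suc κ))) (ℤ.+-monoˡ-< C (s-before F-first r a′ a′<)))
            (subst (λ w → A + C + r * + suc κ ℤ.≤ s w) (sym (proj₂ at-G)) (s-at G-first r))) , at-G
        where
        at-G : b′ ≡ b + 1ℤ × b′ ≡ G + r * + P
        at-G = crossing-up b~b′ b< (above G b′ r (ℤ.<-irrefl (sym eq)))
      level-before : ∀ T z z′ → z′ ≡ z + 1ℤ → z′ ≡ T + r * + P → level T z ≡ r - 1ℤ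
      level-before T z z′ p q = trans (cong (_/ℕ P) (trans (l₁ z T) (trans (cong (λ w → w - T - 1ℤ) (trans (sym p) q))
          (cong (_- 1ℤ) (left-minus T (r * + P)))))) (/ℕ-pred P r)
        where
        l₁ : ∀ z T → z - T ≡ z + 1ℤ - T - 1ℤ
        l₁ = solve-∀
      conclude : (a′ ≡ a + 1ℤ × a′ ≡ F + r * + P) × (b′ ≡ b + 1ℤ × b′ ≡ G + r * + P) → Exit a b a′ b′
      conclude ((pa , qa) , (pb , qb)) = r≡ , pa , pb
          , ℤ.<-≤-trans (s-before G-first r b b<) (subst (λ w → A + C + r * + suc κ ℤ.≤ s w) (sym qb) (s-at G-first r))
          , divides r (trans (cong (_- F) qa) (left-minus F (r * + P)))
          , divides r (trans (cong (_- G) qb) (left-minus G (r * + P)))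
        where
        l₂ : ∀ r → r - 1ℤ + 1ℤ ≡ r
        l₂ = solve-∀
        r≡ : r ≡ rank a b + 1ℤ
        r≡ = sym (trans (cong (_+ 1ℤ) (trans (cong₂ _⊔_ (level-before F a a′ pa qa) (level-before G b b′ pb qb))
          (ℤ.⊔-idem (r - 1ℤ)))) (l₂ r))

    rank-shift : ∀ a b q → rank (a + q * + P) (b + q * + P) ≡ rank a b + q
    rank-shift a b q = trans (cong₂ _⊔_ (level-shift F a) (level-shift G b))
      (sym (ℤ.mono-≤-distrib-⊔ (ℤ.+-monoˡ-≤ q) (level F a) (level G b)))
      where
      lemma : ∀ z c T → (z + c) - T ≡ (z - T) + c
      lemma = solve-∀
      level-shift : ∀ T z → level T (z + q * + P) ≡ level T z + q
      level-shift T z = trans (cong (_/ℕ P) (lemma z (q * + P) T)) (/ℕ-shift P (z - T) q)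

-- Homology classes in symmetric patterns

adjacent-⟦_⟧ : ∀ s {z z′} → z′ ≡ z + ⟦ s ⟧ → Adjacent z z′
adjacent-⟦ Sign.+ ⟧ = up
adjacent-⟦ Sign.- ⟧ = down

adjacent-sym : ∀ {z z′} → Adjacent z z′ → Adjacent z′ z
adjacent-sym {z} (up refl) = down (lemma z)
  where
  lemma : ∀ z → z ≡ z + 1ℤ - 1ℤ
  lemma = solve-∀
adjacent-sym {z} (down refl) = up (lemma z)
  where
  lemma : ∀ z → z ≡ z - 1ℤ + 1ℤ
  lemma = solve-∀

⟦⟧-injective : ∀ s s′ → ⟦ s ⟧ ≡ ⟦ s′ ⟧ → s ≡ s′
⟦⟧-injective Sign.+ Sign.+ _ = refl
⟦⟧-injective Sign.- Sign.- _ = refl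

step-up : ∀ s {z z′} → z′ ≡ z + ⟦ s ⟧ → z′ ≡ z + 1ℤ → s ≡ Sign.+
step-up s {z} p q = ⟦⟧-injective s Sign.+ (+-cancelˡ z _ _ (trans (sym p) q))

step-down : ∀ s {z z′} → z′ ≡ z + ⟦ s ⟧ → z ≡ z′ + 1ℤ → s ≡ Sign.-
step-down s {z} {z′} p q = ⟦⟧-injective s Sign.- (+-cancelˡ z _ _ (trans (sym p) (trans (lemma z′) (cong (_- 1ℤ) (sym q)))))
  where
  lemma : ∀ z → z ≡ z + 1ℤ - 1ℤ
  lemma = solve-∀

module SymmetricLoop {N : ℕ} .{{_ : NonZero N}} {x : Vec Sign N} (L : Loop x x) where

  open LoopWalk L
  open Walk walk using (X; Y; a; b; a-step; b-step)
  open WalkProperties walk using (t; a-rotated; b-rotated)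
  open Height x using (height; height-shift)

  private
    ℓ : ℕ
    ℓ = length L

    instance
      ℓ≢0 : NonZero ℓ
      ℓ≢0 = Loop.nonempty L

  -- A step across a lift of the diagonal would turn at a vertex (i, i), where row and column have the
  -- same sign, so X = Y.
  no-crossing : ∀ m q → b m ≡ a (suc m) + q * (+ 2 * + N) → b (suc m) ≢ a m + q * (+ 2 * + N)
  no-crossing m q p p′ = zero≢ (X m) (Y m) (begin
    ⟦ X m ⟧ * ⟦ Y m ⟧ + ⟦ X m ⟧ * ⟦ Y m ⟧
      ≡⟨ lemma (height (a m)) (q * (+ 2 * k x)) (⟦ X m ⟧ * ⟦ Y m ⟧) ⟩
    ((height (a m) + ⟦ X m ⟧ * ⟦ Y m ⟧) + q * (+ 2 * k x) + ⟦ X m ⟧ * ⟦ Y m ⟧) - (height (a m) + q * (+ 2 * k x))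
      ≡⟨ cong₂ _-_ (cong (_+ ⟦ X m ⟧ * ⟦ Y m ⟧) (cong (_+ q * (+ 2 * k x)) (height-column m))) (height-shift q (a m)) ⟨
    (height (a (suc m)) + q * (+ 2 * k x) + ⟦ X m ⟧ * ⟦ Y m ⟧) - height (a m + q * (+ 2 * + N))
      ≡⟨ cong₂ (λ w w′ → w + ⟦ X m ⟧ * ⟦ Y m ⟧ - w′) (trans (cong height p) (height-shift q (a (suc m)))) (cong height p′) ⟨
    height (b m) + ⟦ X m ⟧ * ⟦ Y m ⟧ - height (b (suc m))
      ≡⟨ cong (λ w → w - height (b (suc m))) (height-row m) ⟨
    height (b (suc m)) - height (b (suc m)) ≡⟨ ℤ.+-inverseʳ (height (b (suc m))) ⟩
    0ℤ ∎)
    where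
    open ≡-Reasoning
    lemma : ∀ h c e → e + e ≡ ((h + e) + c + e) - (h + c)
    lemma = solve-∀
    zero≢ : ∀ s s′ → ⟦ s ⟧ * ⟦ s′ ⟧ + ⟦ s ⟧ * ⟦ s′ ⟧ ≢ 0ℤ
    zero≢ Sign.+ Sign.+ ()
    zero≢ Sign.+ Sign.- ()
    zero≢ Sign.- Sign.+ ()
    zero≢ Sign.- Sign.- ()

  abstract
   -- Of the two doubled coordinates of a midpoint, exactly the one along the edge is odd.
   start-odd : ∃[ c ] b 0 - a 0 ≡ c + c + 1ℤ
   start-odd = by-axis (axis (edge 0)) refl
    where
    p₀ q₀ : ℤ
    p₀ = p horizontal 0
    q₀ = p vertical 0
    odd : ∀ s {d d′} → (d ≡ 0ℤ × d′ ≡ ⟦ s ⟧) ⊎ (d ≡ ⟦ s ⟧ × d′ ≡ 0ℤ) →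
      ∃[ c ] (q₀ + (q₀ + d)) - (p₀ + (p₀ + d′)) ≡ c + c + 1ℤ
    odd Sign.+ (inj₁ (refl , refl)) = q₀ - p₀ - 1ℤ , lemma q₀ p₀
      where
      lemma : ∀ q p → (q + (q + 0ℤ)) - (p + (p + 1ℤ)) ≡ (q - p - 1ℤ) + (q - p - 1ℤ) + 1ℤ
      lemma = solve-∀
    odd Sign.- (inj₁ (refl , refl)) = q₀ - p₀ , lemma q₀ p₀
      where
      lemma : ∀ q p → (q + (q + 0ℤ)) - (p + (p + -1ℤ)) ≡ (q - p) + (q - p) + 1ℤ
      lemma = solve-∀
    odd Sign.+ (inj₂ (refl , refl)) = q₀ - p₀ , lemma q₀ p₀
      where
      lemma : ∀ q p → (q + (q + 1ℤ)) - (p + (p + 0ℤ)) ≡ (q - p) + (q - p) + 1ℤ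
      lemma = solve-∀
    odd Sign.- (inj₂ (refl , refl)) = q₀ - p₀ - 1ℤ , lemma q₀ p₀
      where
      lemma : ∀ q p → (q + (q + -1ℤ)) - (p + (p + 0ℤ)) ≡ (q - p - 1ℤ) + (q - p - 1ℤ) + 1ℤ
      lemma = solve-∀
    by-axis : ∀ A → axis (edge 0) ≡ A → ∃[ c ] b 0 - a 0 ≡ c + c + 1ℤ
    by-axis horizontal eq = odd (sign x x (edge 0)) (inj₁ (δ-across {vertical} 0 eq , δ-along {horizontal} 0 eq))
    by-axis vertical   eq = odd (sign x x (edge 0)) (inj₂ (δ-along {vertical} 0 eq , δ-across {horizontal} 0 eq))

  private
    -- The lifts of the diagonal are the lines b - a = 2qN. Since b - a = 2c + 1 is odd, no midpoint
    -- lies on them, and `c m /ℕ N` numbers the strip between two of them.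
    c : ℕ → ℤ
    c m = proj₁ start-odd + t m

  offset : ∀ m → b m ≡ a m + (c m + c m + 1ℤ)
  offset m = begin
    b m                                             ≡⟨ b-rotated m ⟩
    b 0 + (u m + t m)                               ≡⟨ lemma (a 0) (b 0) (u m) (t m) ⟩
    (a 0 + (u m - t m)) + ((b 0 - a 0) + (t m + t m))
      ≡⟨ cong₂ (λ w w′ → w + (w′ + (t m + t m))) (sym (a-rotated m)) (proj₂ start-odd) ⟩
    a m + ((c₀ + c₀ + 1ℤ) + (t m + t m))            ≡⟨ lemma′ (a m) c₀ (t m) ⟩
    a m + (c m + c m + 1ℤ)                          ∎
    where
    open ≡-Reasoning
    open WalkProperties walk using (u)
    c₀ = proj₁ start-odd
    lemma : ∀ a b u t → b + (u + t) ≡ (a + (u - t)) + ((b - a) + (t + t))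
    lemma = solve-∀
    lemma′ : ∀ a c t → a + ((c + c + 1ℤ) + (t + t)) ≡ a + ((c + t) + (c + t) + 1ℤ)
    lemma′ = solve-∀

  -- b - a is odd and changes by 0 or ±2, so a step out of a strip goes from 2qN ∓ 1 to 2qN ± 1. Its
  -- ends are mirror images in the line between the strips, the configuration that `no-crossing`
  -- excludes.
  strip-constant : ∀ m → c (suc m) /ℕ N ≡ c m /ℕ N
  strip-constant m = go (X m) (Y m) refl refl
    where
    c₀ = proj₁ start-odd
    crossing : ∀ q → a (suc m) ≡ a m - 1ℤ → b (suc m) ≡ b m + 1ℤ → c m + 1ℤ ≢ q * + N
    crossing q p p′ eq = no-crossing m q
      (trans (offset m) (trans (l₁ (a m) (c m)) (trans (cong₂ (λ w w′ → w + + 2 * w′) (sym p) eq) (l₂ (a (suc m)) q (+ N)))))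
      (trans p′ (trans (cong (_+ 1ℤ) (offset m)) (trans (l₃ (a m) (c m))
          (trans (cong (λ w → a m + + 2 * w) eq) (l₂ (a m) q (+ N))))))
      where
      l₁ : ∀ a c → a + (c + c + 1ℤ) ≡ (a - 1ℤ) + + 2 * (c + 1ℤ)
      l₁ = solve-∀
      l₂ : ∀ a q n → a + + 2 * (q * n) ≡ a + q * (+ 2 * n)
      l₂ = solve-∀
      l₃ : ∀ a c → a + (c + c + 1ℤ) + 1ℤ ≡ a + + 2 * (c + 1ℤ)
      l₃ = solve-∀
    crossing′ : ∀ q → a (suc m) ≡ a m + 1ℤ → b (suc m) ≡ b m - 1ℤ → c m ≢ q * + N
    crossing′ q p p′ eq = no-crossing m q
      (trans (offset m) (trans (l₁ (a m) (c m)) (trans (cong₂ (λ w w′ → w + + 2 * w′) (sym p) eq) (l₂ (a (suc m)) q (+ N)))))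
      (trans p′ (trans (cong (_- 1ℤ) (offset m)) (trans (l₃ (a m) (c m))
          (trans (cong (λ w → a m + + 2 * w) eq) (l₂ (a m) q (+ N))))))
      where
      l₁ : ∀ a c → a + (c + c + 1ℤ) ≡ (a + 1ℤ) + + 2 * c
      l₁ = solve-∀
      l₂ : ∀ a q n → a + + 2 * (q * n) ≡ a + q * (+ 2 * n)
      l₂ = solve-∀
      l₃ : ∀ a c → a + (c + c + 1ℤ) - 1ℤ ≡ a + + 2 * c
      l₃ = solve-∀
    c-suc : ∀ s s′ → X m ≡ s → Y m ≡ s′ → c (suc m) ≡ c m + δt s s′
    c-suc s s′ refl refl = sym (ℤ.+-assoc c₀ (t m) (δt (X m) (Y m)))
    go : ∀ s s′ → X m ≡ s → Y m ≡ s′ → c (suc m) /ℕ N ≡ c m /ℕ N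
    go Sign.+ Sign.+ p q = cong (_/ℕ N) (trans (c-suc _ _ p q) (ℤ.+-identityʳ (c m)))
    go Sign.- Sign.- p q = cong (_/ℕ N) (trans (c-suc _ _ p q) (ℤ.+-identityʳ (c m)))
    go Sign.- Sign.+ p q = [ (λ same → trans (cong (_/ℕ N) (c-suc _ _ p q)) same)
      , (λ (r , eq) → contradiction eq (crossing r
          (trans (a-step m) (cong (λ s → a m + ⟦ s ⟧) p)) (trans (b-step m) (cong (λ s → b m + ⟦ s ⟧) q))))
      ]′ (/ℕ-adjacent N (c m))
    go Sign.+ Sign.- p q = [ (λ same → trans (cong (_/ℕ N) (c-suc _ _ p q)) (trans (sym same) (cong (_/ℕ N) (l (c m)))))
      , (λ (r , eq) → contradiction (trans (sym (l (c m))) eq) (crossing′ r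
          (trans (a-step m) (cong (λ s → a m + ⟦ s ⟧) p)) (trans (b-step m) (cong (λ s → b m + ⟦ s ⟧) q))))
      ]′ (/ℕ-adjacent N (c m - 1ℤ))
      where
      l : ∀ z → z - 1ℤ + 1ℤ ≡ z
      l = solve-∀

  module _ {λ′ μ : ℤ} (Δx≡ : Δx L ≡ λ′ * + N) (Δy≡ : Δy L ≡ μ * + N) where

    private
      a-total : a ℓ ≡ a 0 + λ′ * (+ 2 * + N)
      a-total = trans (l₁ (a ℓ) (a 0)) (cong (λ w → a 0 + w)
        (trans (mid-total horizontal) (trans (cong (λ w → + 2 * w) Δx≡) (l₂ λ′ (+ N)))))
        where
        l₁ : ∀ z w → z ≡ w + (z - w)
        l₁ = solve-∀
        l₂ : ∀ q n → + 2 * (q * n) ≡ q * (+ 2 * n)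
        l₂ = solve-∀

      b-total : b ℓ ≡ b 0 + μ * (+ 2 * + N)
      b-total = trans (l₁ (b ℓ) (b 0)) (cong (λ w → b 0 + w)
        (trans (mid-total vertical) (trans (cong (λ w → + 2 * w) Δy≡) (l₂ μ (+ N)))))
        where
        l₁ : ∀ z w → z ≡ w + (z - w)
        l₁ = solve-∀
        l₂ : ∀ q n → + 2 * (q * n) ≡ q * (+ 2 * n)
        l₂ = solve-∀

    -- One traversal adds (μ - λ)N to `c`, which moves the strip number by μ - λ.
    diagonal-class : λ′ ≡ μ
    diagonal-class = sym (ℤ.i-j≡0⇒i≡j μ λ′ (+-cancelˡ (c 0 /ℕ N) _ _ (begin
      c 0 /ℕ N + (μ - λ′)          ≡⟨ /ℕ-shift N (c 0) (μ - λ′) ⟨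
      (c 0 + (μ - λ′) * + N) /ℕ N  ≡⟨ cong (_/ℕ N) c-total ⟨
      c ℓ /ℕ N                     ≡⟨ constant ℓ ⟩
      c 0 /ℕ N                     ≡⟨ ℤ.+-identityʳ _ ⟨
      c 0 /ℕ N + 0ℤ                ∎)))
      where
      open ≡-Reasoning
      constant : ∀ m → c m /ℕ N ≡ c 0 /ℕ N
      constant zero    = refl
      constant (suc m) = trans (strip-constant m) (constant m)
      twice : + 2 * c ℓ ≡ + 2 * (c 0 + (μ - λ′) * + N)
      twice = begin
        + 2 * c ℓ                               ≡⟨ l₁ (a ℓ) (c ℓ) ⟩
        (a ℓ + (c ℓ + c ℓ + 1ℤ)) - a ℓ - 1ℤ     ≡⟨ cong (λ w → w - a ℓ - 1ℤ) (offset ℓ) ⟨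
        b ℓ - a ℓ - 1ℤ                          ≡⟨ cong₂ (λ w w′ → w - w′ - 1ℤ) b-total a-total ⟩
        b 0 + μ * (+ 2 * + N) - (a 0 + λ′ * (+ 2 * + N)) - 1ℤ
          ≡⟨ cong (λ w → w + μ * (+ 2 * + N) - (a 0 + λ′ * (+ 2 * + N)) - 1ℤ) (offset 0) ⟩
        (a 0 + (c 0 + c 0 + 1ℤ)) + μ * (+ 2 * + N) - (a 0 + λ′ * (+ 2 * + N)) - 1ℤ
          ≡⟨ l₂ (a 0) (c 0) μ λ′ (+ N) ⟩
        + 2 * (c 0 + (μ - λ′) * + N)            ∎
        where
        l₁ : ∀ a c → + 2 * c ≡ (a + (c + c + 1ℤ)) - a - 1ℤ
        l₁ = solve-∀
        l₂ : ∀ a c m l n → (a + (c + c + 1ℤ)) + m * (+ 2 * n) - (a + l * (+ 2 * n)) - 1ℤ ≡ + 2 * (c + (m - l) * n)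
        l₂ = solve-∀
      c-total : c ℓ ≡ c 0 + (μ - λ′) * + N
      c-total = ℤ.*-cancelˡ-≡ (+ 2) _ _ twice

    module _ (ε : Sign) {n : ℕ} (k≡ : ⟦ ε ⟧ * k x ≡ + suc n) where

      private
        P κ : ℕ
        P = 2 ℕ.* N
        -- Written so that `suc κ` computes to `2 ℕ.* suc n`, the climb 2|k| of `s` over one period.
        κ = n ℕ.+ suc (n ℕ.+ 0)

        instance
          P≢0 : NonZero P
          P≢0 = ℕ.m*n≢0 2 N

        P≡ : + P ≡ + 2 * + N
        P≡ = ℤ.pos-* 2 N

        s : ℤ → ℤ
        s z = ⟦ ε ⟧ * height z

        s-shift : ∀ q z → s (z + q * + P) ≡ s z + q * + suc κ
        s-shift q z = begin
          ⟦ ε ⟧ * height (z + q * + P)           ≡⟨ cong (λ p → ⟦ ε ⟧ * height (z + q * p)) P≡ ⟩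
          ⟦ ε ⟧ * height (z + q * (+ 2 * + N))   ≡⟨ cong (⟦ ε ⟧ *_) (height-shift q z) ⟩
          ⟦ ε ⟧ * (height z + q * (+ 2 * k x))   ≡⟨ l ⟦ ε ⟧ (height z) q (k x) ⟩
          s z + q * (+ 2 * (⟦ ε ⟧ * k x))        ≡⟨ cong (λ w → s z + q * (+ 2 * w)) k≡ ⟩
          s z + q * + suc κ                      ∎
          where
          open ≡-Reasoning
          l : ∀ e h q k → e * (h + q * (+ 2 * k)) ≡ e * h + q * (+ 2 * (e * k))
          l = solve-∀

        C : ℤ
        C = s (b 0) - s (a 0)

        s-b : ∀ m → s (b m) ≡ s (a m) + C
        s-b zero    = l (s (b 0)) (s (a 0))
          where
          l : ∀ z w → z ≡ w + (z - w)
          l = solve-∀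
        s-b (suc m) = trans (cong (⟦ ε ⟧ *_) (height-row m))
          (trans (ℤ.*-distribˡ-+ ⟦ ε ⟧ (height (b m)) e)
          (trans (cong (_+ ⟦ ε ⟧ * e) (s-b m))
          (trans (l ⟦ ε ⟧ (height (a m)) C e) (cong (λ w → ⟦ ε ⟧ * w + C) (sym (height-column m))))))
          where
          e = ⟦ X m ⟧ * ⟦ Y m ⟧
          l : ∀ ε h c e → (ε * h + c) + ε * e ≡ ε * (h + e) + c
          l = solve-∀

        s-forward : ∀ m → X m ≡ Y m → s (b (suc m)) ≡ s (b m) + ⟦ ε ⟧
        s-forward m eq = trans (cong (⟦ ε ⟧ *_) (trans (height-row m)
            (cong (λ w → height (b m) + w) (trans (cong (λ r → ⟦ r ⟧ * ⟦ Y m ⟧) eq) (square (Y m))))))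
          (l ⟦ ε ⟧ (height (b m)))
          where
          square : ∀ r → ⟦ r ⟧ * ⟦ r ⟧ ≡ 1ℤ
          square Sign.+ = refl
          square Sign.- = refl
          l : ∀ e h → e * (h + 1ℤ) ≡ e * h + e
          l = solve-∀

        open Climbing s P κ s-shift

        F G : ℤ
        F = proj₁ (first-passage 0ℤ)
        G = proj₁ (first-passage (0ℤ + C))

        open Corner {0ℤ} {C} (proj₂ (first-passage 0ℤ)) (proj₂ (first-passage (0ℤ + C)))

        f : ℕ → ℤ
        f m = rank (a m) (b m)

        -- The path passes the corner in the direction of ε, so its later end is the corner if ε = +
        -- and its earlier end is the corner if ε = -.
        corner-index : Sign → ℕ → ℕ
        corner-index Sign.+ m = suc m
        corner-index Sign.- m = m

        Mark : ℕ → Set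
        Mark m = (+ P ∣ a (corner-index ε m) - F) × (+ P ∣ b (corner-index ε m) - G)

        a~ : ∀ m → Adjacent (a m) (a (suc m))
        a~ m = adjacent-⟦ X m ⟧ (a-step m)

        b~ : ∀ m → Adjacent (b m) (b (suc m))
        b~ m = adjacent-⟦ Y m ⟧ (b-step m)

        -- A rise of the rank is an exit with X = Y = +, a drop is an exit of the reversed walk with
        -- X = Y = -. In both cases XY = 1, so the forward step changes `s` by ε; but `s` rises in
        -- the first case and falls in the second, which fixes ε. So the rank can change only by ε
        -- itself.
        increment : ∀ m → f (suc m) ≡ f m ⊎ (f (suc m) ≡ f m + ⟦ ε ⟧ × Mark m)
        increment m = compare (ℤ.<-cmp (f m) (f (suc m)))
          where
          forward : Exit (a m) (b m) (a (suc m)) (b (suc m)) → f (suc m) ≡ f m + ⟦ ε ⟧ × Mark m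
          forward (r , p , q , s< , mF , mG) =
            subst (λ e → f (suc m) ≡ f m + ⟦ e ⟧ × (+ P ∣ a (corner-index e m) - F) × (+ P ∣ b (corner-index e m) - G))
              (sym ε≡+) (r , mF , mG)
            where
            X≡Y = trans (step-up (X m) {a m} (a-step m) p) (sym (step-up (Y m) {b m} (b-step m) q))
            ε≡+ : ε ≡ Sign.+
            ε≡+ = right-step (s (b m)) ε (subst (s (b m) ℤ.≤_) (s-forward m X≡Y) (ℤ.<⇒≤ s<))
          l : ∀ z → z ≡ z + 1ℤ + -1ℤ
          l = solve-∀
          backward : Exit (a (suc m)) (b (suc m)) (a m) (b m) → f (suc m) ≡ f m + ⟦ ε ⟧ × Mark m
          backward (r , p , q , s< , mF , mG) =
            subst (λ e → f (suc m) ≡ f m + ⟦ e ⟧ × (+ P ∣ a (corner-index e m) - F) × (+ P ∣ b (corner-index e m) - G))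
              (sym ε≡-) (trans (l (f (suc m))) (cong (_+ -1ℤ) (sym r)) , mF , mG)
            where
            X≡Y = trans (step-down (X m) (a-step m) p) (sym (step-down (Y m) (b-step m) q))
            ε≡- : ε ≡ Sign.-
            ε≡- = left-step (s (b m)) ε (subst (ℤ._≤ s (b m)) (s-forward m X≡Y) (ℤ.<⇒≤ s<))

          compare : Tri (f m ℤ.< f (suc m)) (f m ≡ f (suc m)) (f (suc m) ℤ.< f m) →
            f (suc m) ≡ f m ⊎ (f (suc m) ≡ f m + ⟦ ε ⟧ × Mark m)
          compare (tri≈ _ eq _) = inj₁ (sym eq)
          compare (tri< lt _ _) = inj₂ (forward (exit (a~ m) (b~ m) (s-b m) (s-b (suc m)) lt))
          compare (tri> _ _ gt) =
            inj₂ (backward (exit (adjacent-sym (a~ m)) (adjacent-sym (b~ m)) (s-b (suc m)) (s-b m) gt))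

        same-edge : ∀ {i j} → (+ P ∣ a i - F) × (+ P ∣ b i - G) → (+ P ∣ a j - F) × (+ P ∣ b j - G) → edge i ≡ edge j
        same-edge {i} {j} (p , q) (p′ , q′) = mid-injective i j λ where
            horizontal → subst₂ _∣_ P≡ (l (a i) (a j) F) (∣m∣n⇒∣m-n p p′)
            vertical   → subst₂ _∣_ P≡ (l (b i) (b j) G) (∣m∣n⇒∣m-n q q′)
          where
          l : ∀ z w c → (z - c) - (w - c) ≡ z - w
          l = solve-∀

        once : ∀ i d → suc d ℕ.< ℓ → Mark i → ¬ Mark (suc d ℕ.+ i)
        once i d d<ℓ Mi Mj = edge-simple (corner-index ε i) d d<ℓ
          (trans (same-edge Mi Mj) (cong edge (shift-index ε)))
          where
          shift-index : ∀ e → corner-index e (suc d ℕ.+ i) ≡ suc d ℕ.+ corner-index e i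
          shift-index Sign.+ = sym (ℕ.+-suc (suc d) i)
          shift-index Sign.- = refl

        f-total : f ℓ ≡ f 0 + λ′
        f-total = begin
          rank (a ℓ) (b ℓ)                             ≡⟨ cong₂ rank a-ℓ b-ℓ ⟩
          rank (a 0 + λ′ * + P) (b 0 + λ′ * + P)       ≡⟨ rank-shift (a 0) (b 0) λ′ ⟩
          rank (a 0) (b 0) + λ′                        ∎
          where
          open ≡-Reasoning
          a-ℓ : a ℓ ≡ a 0 + λ′ * + P
          a-ℓ = trans a-total (cong (λ p → a 0 + λ′ * p) (sym P≡))
          b-ℓ : b ℓ ≡ b 0 + λ′ * + P
          b-ℓ = trans b-total (cong₂ (λ r p → b 0 + r * p) (sym diagonal-class) (sym P≡))

      -- One traversal shifts the lifted point diagonally by λ periods and so raises the rank by λ,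
      -- while the rank changes at most once, by ε.
      primitive-class : λ′ ≡ 0ℤ ⊎ λ′ ≡ ⟦ ε ⟧
      primitive-class = Sum.map
        (λ eq → +-cancelˡ (f 0) λ′ 0ℤ (trans (sym f-total) (trans eq (sym (ℤ.+-identityʳ (f 0))))))
        (λ eq → +-cancelˡ (f 0) λ′ ⟦ ε ⟧ (trans (sym f-total) eq))
        (increments-≤1 f ⟦ ε ⟧ Mark ℓ increment once)

-- Lengths modulo 8

module _ {ℓ : ℕ} (W : Walk ℓ) where
  open Walk W
  open WalkProperties W
  open Winding u t step using (τ)

  turn-at-period≢1 : ∀ m → v (suc m) ≢ v m
  turn-at-period≢1 m eq with turn m
  ... | inj₁ (p , q , _) = contradiction (trans (sym q) (trans eq p)) λ ()
  ... | inj₂ (p , q , _) = contradiction (trans (sym p) (trans (sym eq) q)) λ ()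

  -- The factor 4 in `length-formula` meets the even correction in `∑s`: their product is the
  -- multiple of 8.
  length-mod-8 : ∀ {w} → ∑ τ ℓ ≡ w → (h : ℕ → ℤ) → (∀ m → h (suc m) ≡ h m + ⟦ X m ⟧ * ⟦ Y m ⟧) →
    ∃[ q ] + ℓ ≡ (a ℓ - a 0) + (b ℓ - b 0) - (h ℓ - h 0) + + 4 * w + q * + 8
  length-mod-8 {w} ∑τ≡w h h-step = V , (begin
    + ℓ                                 ≡⟨ length-formula h h-step ⟩
    D + + 4 * ∑ s ℓ                     ≡⟨ cong (λ z → D + + 4 * z) (trans ∑s (cong (_+ + 2 * V) ∑τ≡w)) ⟩
    D + + 4 * (w + + 2 * V)             ≡⟨ lemma D w V ⟩
    D + + 4 * w + V * + 8               ∎)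
    where
    open ≡-Reasoning
    D V : ℤ
    D = (a ℓ - a 0) + (b ℓ - b 0) - (h ℓ - h 0)
    V = ∑ (λ i → v i * s i) ℓ
    lemma : ∀ d w v → d + + 4 * (w + + 2 * v) ≡ d + + 4 * w + v * + 8
    lemma = solve-∀

essential-∑τ : ∀ {ℓ} (W : Walk ℓ) (let open Walk W) (let open WalkProperties W) →
  ¬ (a ℓ ≡ a 0 × b ℓ ≡ b 0) → ∑ (Winding.τ u t step) ℓ ≡ 0ℤ
essential-∑τ {zero}        W essential = refl
essential-∑τ {suc zero}    W essential = contradiction (Walk.v-period W 0) (turn-at-period≢1 W 0)
essential-∑τ {suc (suc d)} W essential = essential-winding W essential

contractible-∑τ : ∀ {ℓ} .{{_ : NonZero ℓ}} (W : Walk ℓ) (let open Walk W) (let open WalkProperties W) →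
  a ℓ ≡ a 0 → b ℓ ≡ b 0 → ∃[ s ] ∑ (Winding.τ u t step) ℓ ≡ ⟦ s ⟧
contractible-∑τ {suc zero}    W p q = contradiction (Walk.v-period W 0) (turn-at-period≢1 W 0)
-- In length 2 the turn keeps X or Y, so one coordinate moves by ±2 in total and the walk does not
-- close.
contractible-∑τ {suc (suc zero)} W p q = ⊥-elim (straight (turn 0))
  where
  open Walk W
  back : ∀ z s s′ → z + ⟦ s ⟧ + ⟦ s′ ⟧ ≡ z → s ≢ s′
  back z s _ eq refl = nonzero s (+-cancelˡ z _ 0ℤ
      (trans (sym (ℤ.+-assoc z ⟦ s ⟧ ⟦ s ⟧)) (trans eq (sym (ℤ.+-identityʳ z)))))
    where
    nonzero : ∀ s → ⟦ s ⟧ + ⟦ s ⟧ ≢ 0ℤ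
    nonzero Sign.+ ()
    nonzero Sign.- ()
  straight : ¬ _
  straight (inj₁ (_ , _ , x)) = back (a 0) (X 0) (X 1)
    (trans (sym (trans (a-step 1) (cong (_+ ⟦ X 1 ⟧) (a-step 0)))) p) x
  straight (inj₂ (_ , _ , y)) = back (b 0) (Y 0) (Y 1)
    (trans (sym (trans (b-step 1) (cong (_+ ⟦ Y 1 ⟧) (b-step 0)))) q) y
contractible-∑τ {suc (suc (suc d))} W p q = _ , contractible-winding W p q

module LoopLength {M N : ℕ} .{{_ : NonZero M}} .{{_ : NonZero N}} {x : Vec Sign N} {y : Vec Sign M}
  (L : Loop x y) {λ′ μ : ℤ} (class : homologyClass L ≡ (λ′ , μ)) where

  open LoopWalk L
  open Walk walk using (a; b)
  open WalkProperties walk using (u; t; step)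
  open Height x

  private
    ℓ : ℕ
    ℓ = length L

    instance
      ℓ≢0 : NonZero ℓ
      ℓ≢0 = Loop.nonempty L

  Δx≡ : Δx L ≡ λ′ * + M
  Δx≡ = trans (_∣_.equality (M∣Δx L)) (cong (λ c → proj₁ c * + M) class)

  Δy≡ : Δy L ≡ μ * + N
  Δy≡ = trans (_∣_.equality (N∣Δy L)) (cong (λ c → proj₂ c * + N) class)

  a-total : a ℓ - a 0 ≡ + 2 * (λ′ * + M)
  a-total = trans (mid-total horizontal) (cong (+ 2 *_) Δx≡)

  b-total : b ℓ - b 0 ≡ + 2 * (μ * + N)
  b-total = trans (mid-total vertical) (cong (+ 2 *_) Δy≡)

  height-total : height (b ℓ) - height (b 0) ≡ μ * (+ 2 * k x)
  height-total = trans (cong (_- height (b 0)) (trans (cong height b≡) (height-shift μ (b 0))))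
    (left-minus (height (b 0)) _)
    where
    lemma : ∀ z w → z ≡ w + (z - w)
    lemma = solve-∀
    lemma′ : ∀ q n → + 2 * (q * n) ≡ q * (+ 2 * n)
    lemma′ = solve-∀
    b≡ : b ℓ ≡ b 0 + μ * (+ 2 * + N)
    b≡ = trans (lemma (b ℓ) (b 0)) (cong (λ w → b 0 + w) (trans b-total (lemma′ μ (+ N))))

  trivial-length : λ′ ≡ 0ℤ → μ ≡ 0ℤ → + ℓ ≡ + 4 [mod + 8 ]
  trivial-length λ′≡0 μ≡0 = by-sign (contractible-∑τ walk
      (ℤ.i-j≡0⇒i≡j (a ℓ) (a 0) a-closed) (ℤ.i-j≡0⇒i≡j (b ℓ) (b 0) b-closed))
    where
    a-closed : a ℓ - a 0 ≡ 0ℤ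
    a-closed = trans a-total (cong (λ c → + 2 * (c * + M)) λ′≡0)
    b-closed : b ℓ - b 0 ≡ 0ℤ
    b-closed = trans b-total (cong (λ c → + 2 * (c * + N)) μ≡0)
    height-closed : height (b ℓ) - height (b 0) ≡ 0ℤ
    height-closed = trans height-total (cong (_* (+ 2 * k x)) μ≡0)
    D : ℤ
    D = (a ℓ - a 0) + (b ℓ - b 0) - (height (b ℓ) - height (b 0))
    D≡0 : D ≡ 0ℤ
    D≡0 = cong₂ _-_ (cong₂ _+_ a-closed b-closed) height-closed
    by-multiple : ∀ s → ∃[ q ] + ℓ ≡ D + + 4 * ⟦ s ⟧ + q * + 8 → + ℓ ≡ + 4 [mod + 8 ]
    by-multiple Sign.+ (q , eq) = divides q (trans
        (cong (_- + 4) (trans eq (cong (λ z → z + + 4 * 1ℤ + q * + 8) D≡0))) (lemma q))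
      where
      lemma : ∀ q → 0ℤ + + 4 * 1ℤ + q * + 8 - + 4 ≡ q * + 8
      lemma = solve-∀
    -- For the opposite orientation the term is -4, which becomes 4 by taking one 8 from the
    -- quotient.
    by-multiple Sign.- (q , eq) = divides (q - 1ℤ)
        (trans (cong (_- + 4) (trans eq (cong (λ z → z + + 4 * -1ℤ + q * + 8) D≡0))) (lemma q))
      where
      lemma : ∀ q → 0ℤ + + 4 * -1ℤ + q * + 8 - + 4 ≡ (q - 1ℤ) * + 8
      lemma = solve-∀
    by-sign : ∃[ s ] ∑ (Winding.τ u t step) ℓ ≡ ⟦ s ⟧ → + ℓ ≡ + 4 [mod + 8 ]
    by-sign (s , ∑τ≡s) = by-multiple s (length-mod-8 walk ∑τ≡s (height ∘ b) height-row)

  nontrivial-length : ¬ (λ′ ≡ 0ℤ × μ ≡ 0ℤ) →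
    + ℓ ≡ + 2 * (μ * + N + λ′ * + M - μ * k x) [mod + 8 ]
  nontrivial-length nontrivial = conclude (length-mod-8 walk
    (essential-∑τ walk (λ (p , q) → nontrivial (unwrapped λ′ M a-total p , unwrapped μ N b-total q)))
    (height ∘ b) height-row)
    where
    unwrapped : ∀ c n .{{_ : NonZero n}} {z w} → z - w ≡ + 2 * (c * + n) → z ≡ w → c ≡ 0ℤ
    unwrapped c n {z} {w} eq z≡w = ℤ.*-cancelʳ-≡ c 0ℤ (+ n) (ℤ.*-cancelˡ-≡ (+ 2) (c * + n) 0ℤ
      (trans (sym eq) (ℤ.i≡j⇒i-j≡0 z≡w)))
    lemma : ∀ l m M N k q → + 2 * (l * M) + + 2 * (m * N) - m * (+ 2 * k) + + 4 * 0ℤ + q * + 8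
      - + 2 * (m * N + l * M - m * k) ≡ q * + 8
    lemma = solve-∀
    conclude : ∃[ q ] + ℓ ≡ (a ℓ - a 0) + (b ℓ - b 0) - (height (b ℓ) - height (b 0)) + + 4 * 0ℤ + q * + 8 →
      + ℓ ≡ + 2 * (μ * + N + λ′ * + M - μ * k x) [mod + 8 ]
    conclude (q , eq) = divides q (trans (cong (_- + 2 * (μ * + N + λ′ * + M - μ * k x)) (trans eq
        (cong (λ z → z + + 4 * 0ℤ + q * + 8) (cong₂ _-_ (cong₂ _+_ a-total b-total) height-total))))
      (lemma λ′ μ (+ M) (+ N) (k x) q))

k-parity : ∀ {n} (x : Vec Sign n) → ∃[ c ] + n ≡ k x + + 2 * c
k-parity []       = 0ℤ , refl
k-parity {suc n} (s ∷ x) with k-parity x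
... | c , eq = from-head s
  where
  from-head : ∀ s → ∃[ c ] + suc n ≡ k (s ∷ x) + + 2 * c
  from-head Sign.+ = c , trans (cong (λ z → 1ℤ + z) eq) (trans (lemma (k x) c) (cong (_+ + 2 * c) (sym (k-∷ Sign.+ x))))
    where
    lemma : ∀ k c → 1ℤ + (k + + 2 * c) ≡ 1ℤ + k + + 2 * c
    lemma = solve-∀
  from-head Sign.- = c + 1ℤ , trans (cong (λ z → 1ℤ + z) eq)
      (trans (lemma (k x) c) (cong (_+ + 2 * (c + 1ℤ)) (sym (k-∷ Sign.- x))))
    where
    lemma : ∀ k c → 1ℤ + (k + + 2 * c) ≡ -1ℤ + k + + 2 * (c + 1ℤ)
    lemma = solve-∀

symmetric-congruence : ∀ z l m n k c {κ} → l ≡ m → l * k ≡ κ → n ≡ k + + 2 * c →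
  z ≡ + 2 * (m * n + l * n - m * k) [mod + 8 ] → z ≡ + 2 * κ [mod + 8 ]
symmetric-congruence z l _ _ k c refl refl refl 8∣ = subst (+ 8 ∣_) (lemma z l k c)
  -- With N = k + 2c the formula 2(2λN - λk) equals 2λk + 8λc.
  (∣m∣n⇒∣m+n 8∣ (divides (l * c) refl))
  where
  lemma : ∀ z l k c → (z - + 2 * (l * (k + + 2 * c) + l * (k + + 2 * c) - l * k)) + l * c * + 8
    ≡ z - + 2 * (l * k)
  lemma = solve-∀

module _ {N : ℕ} .{{_ : NonZero N}} {x : Vec Sign N} (L : Loop x x) where

  open LoopLength L refl

  private
    λ′ μ : ℤ
    λ′ = proj₁ (homologyClass L)
    μ  = proj₂ (homologyClass L)

    λ′≡μ : λ′ ≡ μ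
    λ′≡μ = SymmetricLoop.diagonal-class L {λ′} {μ} Δx≡ Δy≡

  class-sign : Nontrivial L → λ′ * k x ≡ + ∣ k x ∣
  class-sign nontrivial = by-sign (k x) refl
    where
    λ′≢0 : λ′ ≢ 0ℤ
    λ′≢0 eq = nontrivial (cong₂ _,_ eq (trans (sym λ′≡μ) eq))
    unit : ∀ ε {n} → ⟦ ε ⟧ * k x ≡ + suc n → λ′ ≡ ⟦ ε ⟧
    unit ε eq = [ (λ z → contradiction z λ′≢0) , (λ e → e) ]′ (SymmetricLoop.primitive-class L {λ′} {μ} Δx≡ Δy≡ ε eq)
    by-sign : ∀ c → k x ≡ c → λ′ * c ≡ + ∣ c ∣
    -- Here the quadrant argument says nothing about λ, but both sides vanish.
    by-sign (+ zero)  eq = ℤ.*-zeroʳ λ′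
    by-sign (+ suc n) eq = trans (cong (_* + suc n) (unit Sign.+ (trans (cong (1ℤ *_) eq) (ℤ.*-identityˡ (+ suc n)))))
      (ℤ.*-identityˡ (+ suc n))
    by-sign -[1+ n ]  eq = trans (cong (_* -[1+ n ]) (unit Sign.- (trans (cong (-1ℤ *_) eq) (ℤ.-1*i≡-i -[1+ n ]))))
      (ℤ.-1*i≡-i -[1+ n ])

  symmetric-length : Nontrivial L → + length L ≡ + 2 * + ∣ k x ∣ [mod + 8 ]
  symmetric-length nontrivial = symmetric-congruence (+ length L) λ′ μ (+ N) (k x) (proj₁ (k-parity x))
    λ′≡μ (class-sign nontrivial) (proj₂ (k-parity x))
    (nontrivial-length λ (p , q) → nontrivial (cong₂ _,_ p q))

theorem1p6 : (M N : ℕ) → 3 ≤ M → 3 ≤ N →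
    ((x : Vec Sign N) (y : Vec Sign M) (L : Loop x y) → Trivial L →
    + length L ≡ + 4 [mod + 8 ])
    × ((x : Vec Sign N) (L : Loop x x) → Nontrivial L →
    + length L ≡ + 2 * + ∣ k x ∣ [mod + 8 ])
    × ((x : Vec Sign N) (y : Vec Sign M) (L : Loop x y) → Nontrivial L →
    (λ′ μ : ℤ) → homologyClass L ≡ (λ′ , μ) →
    + length L ≡ + 2 * (μ * + N + λ′ * + M - μ * k x) [mod + 8 ])
theorem1p6 (suc M) (suc N) _ _ =
    (λ x y L trivial → LoopLength.trivial-length L trivial refl refl)
  , (λ x L nontrivial → symmetric-length L nontrivial)
  , (λ x y L nontrivial λ′ μ class → LoopLength.nontrivial-length L class
      λ (p , q) → nontrivial (trans class (cong₂ _,_ p q)))
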